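{- Let $M\subseteq H\subseteq F\subseteq\omega$ be $\Pi^1_1$ sets. Then there exists a computable function $g$ such that for every $p\in\omega$, $g(p)$ is an $\iota$-index of a c.e. effective quasi-Polish space $X=\iota(g(p))$ such that: $X$ is metrizable if $p\in M$; $X$ is Hausdorff but not metrizable if $p\in H\setminus M$; $X$ is $T_1$ but not Hausdorff if $p\in F\setminus H$; and $X$ is not $T_1$ if $p\notin F$.
   Context: Let $(W_n)$ be a standard numbering of c.e. subsets of $\omega$, $V_n=\{(i,j)\mid\langle i,j\rangle\in W_n\}$, and $t$ a computable function with $V_{t(n)}$ the transitive closure of $V_n$. For a transitive relation $\prec$ on $\omega$, an ideal is a non-empty lower, directed subset of $\omega$; $\mathcal{I}(\prec)$ is the space of ideals with topology generated by $[k]_\prec=\{I\mid k\in I\}$, an effective space with basic opens numbered by $k$. The numbering $\iota$ is defined by $\iota(n)=\mathcal{I}(V_{t(n)})$; an $\iota$-index of $X$ is an $n$ with $X=\iota(n)$. Every $\iota(n)$ is an effective quasi-Polish space; it is c.e. (overt) if $\{k\mid[k]_{V_{t(n)}}\neq\emptyset\}$ is c.e. -}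

module Defs where

open import Data.Empty using (⊥-elim)
open import Data.Fin using (Fin; toℕ)
open import Data.List using (List; []; _∷_; applyUpTo)
open import Data.Nat as ℕ using (ℕ; zero; suc)
open import Data.Product using (Σ; ∃; ∃-syntax; _×_; _,_; proj₁; proj₂)
open import Data.Rational as ℚ using (ℚ; 0ℚ)
import Data.Rational.Properties as ℚ
open import Data.Vec using (Vec; []; _∷_; lookup)
open import Data.Vec.Relation.Binary.Pointwise.Inductive using (Pointwise)
open import Function using (_⇔_)
open import Function.Bundles using (Inverse)
open import Function.Metric.Structures using (IsGeneralMetric)
open import Level using (Level; 0ℓ) renaming (suc to ℓsuc)
open import Relation.Binary.Bundles using (Setoid)
open import Relation.Binary.Construct.Closure.Transitive using (TransClosure)
open import Relation.Binary.Core using (Rel)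
open import Relation.Binary.Definitions using (Transitive; tri<; tri≈; tri>; _Respects_)
open import Relation.Binary.PropositionalEquality using (_≡_; refl; sym; trans; cong; subst)
open import Relation.Nullary using (¬_)
open import Relation.Unary using (Pred; _∈_; _∉_; _⊆_; _≐_; _∩_; Empty; Satisfiable)
open import Relation.Unary.Properties using (≐-refl; ≐-sym; ≐-trans)

private variable
  ℓ : Level
  k m : ℕ

data Rec : ℕ → Set where
  zero : Rec k
  suc  : Rec 1
  proj : Fin k → Rec k
  comp : Rec m → Vec (Rec k) m → Rec k
  prec : Rec k → Rec (2 ℕ.+ k) → Rec (suc k)
  mu   : Rec (suc k) → Rec k

infix 4 _[_]⇓_

-- c [ xs ]⇓ y : the partial function denoted by c is defined at xs, with
-- value y.  In prec the recursion runs on the first argument, and the step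
-- function receives the predecessor and then the previous value.
data _[_]⇓_ : Rec k → Vec ℕ k → ℕ → Set where
  ⇓zero : {xs : Vec ℕ k} → zero [ xs ]⇓ 0
  ⇓suc  : ∀ {x} → suc [ x ∷ [] ]⇓ suc x
  ⇓proj : {xs : Vec ℕ k} (i : Fin k) → proj i [ xs ]⇓ lookup xs i
  ⇓comp : {f : Rec m} {gs : Vec (Rec k) m} {xs : Vec ℕ k} {ys : Vec ℕ m} {z : ℕ} →
          Pointwise (λ g y → g [ xs ]⇓ y) gs ys → f [ ys ]⇓ z →
          comp f gs [ xs ]⇓ z
  ⇓prec-zero : {f : Rec k} {g : Rec (2 ℕ.+ k)} {xs : Vec ℕ k} {z : ℕ} →
          f [ xs ]⇓ z → prec f g [ 0 ∷ xs ]⇓ z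
  ⇓prec-suc  : {f : Rec k} {g : Rec (2 ℕ.+ k)} {xs : Vec ℕ k} {n y z : ℕ} →
          prec f g [ n ∷ xs ]⇓ y → g [ n ∷ y ∷ xs ]⇓ z →
          prec f g [ suc n ∷ xs ]⇓ z
  ⇓mu   : {f : Rec (suc k)} {xs : Vec ℕ k} {n : ℕ} →
          f [ n ∷ xs ]⇓ 0 → (∀ {i} → i ℕ.< n → ∃[ y ] f [ i ∷ xs ]⇓ suc y) →
          mu f [ xs ]⇓ n

Computable : (ℕ → ℕ) → Set
Computable f = Σ (Rec 1) λ c → ∀ n → c [ n ∷ [] ]⇓ f n

CE : Pred ℕ ℓ → Set ℓ
CE A = Σ (Rec 1) λ c → ∀ n → n ∈ A ⇔ (∃[ y ] c [ n ∷ [] ]⇓ y)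

CE₂ : Rel ℕ ℓ → Set ℓ
CE₂ R = Σ (Rec 2) λ c → ∀ m n → R m n ⇔ (∃[ y ] c [ m ∷ n ∷ [] ]⇓ y)

triangle : ℕ → ℕ
triangle zero    = 0
triangle (suc n) = suc n ℕ.+ triangle n

-- Cantor's pairing function.
⟨_,_⟩ : ℕ → ℕ → ℕ
⟨ i , j ⟩ = triangle (i ℕ.+ j) ℕ.+ j

codeSeq : List ℕ → ℕ
codeSeq []       = 0
codeSeq (x ∷ xs) = suc ⟨ x , codeSeq xs ⟩

-- Gödel numbers.  The coding is injective on each Rec k; the intermediate
-- arity of a composition is recorded for that reason.
code  : Rec k → ℕ
codes : Vec (Rec k) m → ℕ

code zero             = ⟨ 0 , 0 ⟩
code suc              = ⟨ 1 , 0 ⟩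
code (proj i)         = ⟨ 2 , toℕ i ⟩
code (comp {m} f gs)  = ⟨ 3 , ⟨ m , ⟨ code f , codes gs ⟩ ⟩ ⟩
code (prec f g)       = ⟨ 4 , ⟨ code f , code g ⟩ ⟩
code (mu f)           = ⟨ 5 , code f ⟩

codes []       = 0
codes (g ∷ gs) = ⟨ code g , codes gs ⟩

-- W n is the domain of the unary partial recursive function with Gödel
-- number n, and is empty if n is not the Gödel number of any.
W : ℕ → Pred ℕ 0ℓ
W n x = Σ (Rec 1) λ c → code c ≡ n × ∃[ y ] c [ x ∷ [] ]⇓ y

V : ℕ → Rel ℕ 0ℓ
V n i j = ⟨ i , j ⟩ ∈ W n

ComputesTransClosure : (ℕ → ℕ) → Set
ComputesTransClosure t = Computable t × (∀ n i j → V (t n) i j ⇔ TransClosure (V n) i j)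

-- P = { p | ∀ f ∈ ω^ω. (p , f) ∈ U } for an effectively open U ⊆ ω × ω^ω,
-- where U is the union of the sets { p } × [ σ ] with (p , σ) ranging over a
-- c.e. set; "f extends σ for some listed σ" says that some initial segment
-- of f is listed.
Π¹₁ : Pred ℕ 0ℓ → Set₁
Π¹₁ P = Σ (Rel ℕ 0ℓ) λ R → CE₂ R ×
  (∀ p → p ∈ P ⇔ (∀ (f : ℕ → ℕ) → ∃[ n ] R p (codeSeq (applyUpTo f n))))

record NumberedSpace : Set₂ where
  field
    points     : Setoid (ℓsuc 0ℓ) 0ℓ
  open Setoid points public using (_≈_) renaming (Carrier to Point)
  field
    basic      : ℕ → Pred Point 0ℓ
    basic-resp : ∀ n → basic n Respects _≈_
    covers     : ∀ x → ∃[ n ] x ∈ basic n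
    meets      : ∀ m n x → x ∈ basic m → x ∈ basic n →
                 ∃[ l ] (x ∈ basic l × basic l ⊆ basic m ∩ basic n)

  Open : Pred Point 0ℓ → Set₁
  Open U = ∀ x → x ∈ U → ∃[ n ] (x ∈ basic n × basic n ⊆ U)

open NumberedSpace using (Point; points; basic)

Overt : NumberedSpace → Set₁
Overt X = CE (λ n → Satisfiable (basic X n))

T₁ : NumberedSpace → Set₁
T₁ X = ∀ x y → ¬ x ≈ y → Σ (Pred (Point X) 0ℓ) λ U → Open U × x ∈ U × y ∉ U
  where open NumberedSpace X using (_≈_; Open)

Hausdorff : NumberedSpace → Set₁
Hausdorff X = ∀ x y → ¬ x ≈ y →
  Σ (Pred (Point X) 0ℓ) λ U₁ → Σ (Pred (Point X) 0ℓ) λ U₂ →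
  Open U₁ × Open U₂ × x ∈ U₁ × y ∈ U₂ × Empty (U₁ ∩ U₂)
  where open NumberedSpace X using (_≈_; Open)

-- Effective continuity: preimages of basic open sets are c.e. open, uniformly.
EffectivelyContinuous : (X Y : NumberedSpace) → (Point X → Point Y) → Set₁
EffectivelyContinuous X Y f = Σ (Rel ℕ 0ℓ) λ R → CE₂ R ×
  (∀ n x → f x ∈ basic Y n ⇔ (∃[ m ] (R n m × x ∈ basic X m)))

EffectivelyHomeomorphic : (X Y : NumberedSpace) → Set₁
EffectivelyHomeomorphic X Y = Σ (Inverse (points X) (points Y)) λ h →
  EffectivelyContinuous X Y (Inverse.to h) × EffectivelyContinuous Y X (Inverse.from h)

record IsIdeal (_≺_ : Rel ℕ 0ℓ) (I : Pred ℕ 0ℓ) : Set where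
  field
    nonempty : Satisfiable I
    lower    : ∀ {i j} → i ≺ j → j ∈ I → i ∈ I
    directed : ∀ {i j} → i ∈ I → j ∈ I → ∃[ l ] (l ∈ I × i ≺ l × j ≺ l)

𝓘 : Rel ℕ 0ℓ → NumberedSpace
𝓘 _≺_ = record
  { points = record
    { Carrier = Σ (Pred ℕ 0ℓ) (IsIdeal _≺_)
    ; _≈_ = λ I J → proj₁ I ≐ proj₁ J
    ; isEquivalence = record { refl = ≐-refl ; sym = ≐-sym ; trans = ≐-trans }
    }
  ; basic = λ n I → n ∈ proj₁ I
  ; basic-resp = λ _ I≐J → proj₁ I≐J
  ; covers = λ I → IsIdeal.nonempty (proj₂ I)
  ; meets = λ m n I m∈I n∈I →
      let (l , l∈I , m≺l , n≺l) = IsIdeal.directed (proj₂ I) m∈I n∈I in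
      l , l∈I , λ {J} l∈J → IsIdeal.lower (proj₂ J) m≺l l∈J , IsIdeal.lower (proj₂ J) n≺l l∈J
  }

-- The function t is the one producing transitive closures.
ι : (t : ℕ → ℕ) → ℕ → NumberedSpace
ι t n = 𝓘 (V (t n))

EffectiveQuasiPolish : NumberedSpace → Set₁
EffectiveQuasiPolish X = Σ (Rel ℕ 0ℓ) λ _≺_ →
  CE₂ _≺_ × Transitive _≺_ × EffectivelyHomeomorphic X (𝓘 _≺_)

-- Dedekind cuts, given by their lower halves.
record ℝ : Set₁ where
  field
    cut     : Pred ℚ 0ℓ
    inhab   : Satisfiable cut
    proper  : ∃[ q ] q ∉ cut
    down    : ∀ {p q} → p ℚ.< q → q ∈ cut → p ∈ cut
    rounded : ∀ {p} → p ∈ cut → ∃[ q ] (p ℚ.< q × q ∈ cut)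

open ℝ

infix 4 _≈ᴿ_ _≤ᴿ_ _<ᴿ_
infixl 6 _+ᴿ_

_≈ᴿ_ _≤ᴿ_ _<ᴿ_ : Rel ℝ 0ℓ
x ≈ᴿ y = cut x ≐ cut y
x ≤ᴿ y = cut x ⊆ cut y
x <ᴿ y = ∃[ q ] (q ∉ cut x × q ∈ cut y)

private
  above : ∀ x {p q} → q ∉ cut x → p ∈ cut x → p ℚ.< q
  above x {p} {q} q∉ p∈ with ℚ.<-cmp p q
  ... | tri< p<q _ _ = p<q
  ... | tri≈ _ refl _ = ⊥-elim (q∉ p∈)
  ... | tri> _ _ q<p = ⊥-elim (q∉ (down x q<p p∈))

  cancel : ∀ p q → (p ℚ.- q) ℚ.+ q ≡ p
  cancel p q = trans (ℚ.+-assoc p (ℚ.- q) q)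
    (trans (cong (p ℚ.+_) (ℚ.+-inverseˡ q)) (ℚ.+-identityʳ p))

  cancel′ : ∀ p q → (p ℚ.+ q) ℚ.- q ≡ p
  cancel′ p q = trans (ℚ.+-assoc p q (ℚ.- q))
    (trans (cong (p ℚ.+_) (ℚ.+-inverseʳ q)) (ℚ.+-identityʳ p))

0ᴿ : ℝ
0ᴿ = record
  { cut     = ℚ._< 0ℚ
  ; inhab   = ℚ.- ℚ.1ℚ , ℚ.negative⁻¹ (ℚ.- ℚ.1ℚ)
  ; proper  = 0ℚ , ℚ.<-irrefl refl
  ; down    = ℚ.<-trans
  ; rounded = λ p<0 → let (q , p<q , q<0) = ℚ.<-dense p<0 in q , p<q , q<0
  }

_+ᴿ_ : ℝ → ℝ → ℝ
x +ᴿ y = record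
  { cut     = λ r → ∃[ p ] ∃[ q ] (p ∈ cut x × q ∈ cut y × r ≡ p ℚ.+ q)
  ; inhab   = _ , _ , _ , proj₂ (inhab x) , proj₂ (inhab y) , refl
  ; proper  = proj₁ (proper x) ℚ.+ proj₁ (proper y) ,
      λ { (p , q , p∈ , q∈ , eq) → ℚ.<-irrefl (sym eq)
            (ℚ.+-mono-< (above x (proj₂ (proper x)) p∈) (above y (proj₂ (proper y)) q∈)) }
  ; down    = λ { {r} {s} r<s (p , q , p∈ , q∈ , refl) →
      r ℚ.- q , q ,
      down x (subst (r ℚ.- q ℚ.<_) (cancel′ p q) (ℚ.+-monoˡ-< (ℚ.- q) r<s)) p∈ ,
      q∈ , sym (cancel r q) }
  ; rounded = λ { (p , q , p∈ , q∈ , refl) →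
      let (p′ , p<p′ , p′∈) = rounded x p∈ in
      p′ ℚ.+ q , ℚ.+-monoˡ-< q p<p′ , p′ , q , p′∈ , q∈ , refl }
  }

Metrizable : NumberedSpace → Set₁
Metrizable X = Σ (Point X → Point X → ℝ) λ d →
  IsGeneralMetric _≈_ _≈ᴿ_ _≤ᴿ_ 0ᴿ _+ᴿ_ d ×
  (∀ (U : Pred (Point X) 0ℓ) →
    Open U ⇔ (∀ x → x ∈ U → ∃[ ε ] (0ᴿ <ᴿ ε × (∀ y → d x y <ᴿ ε → y ∈ U))))
  where open NumberedSpace X using (_≈_; Open)

-- The complement of each Π¹₁ set consists of the p at which a computable tree
-- T p has an infinite path.  Over a tree we build the space of ideals of a
-- decidable transitive relation on labelled nodes and additional "stars".  A
-- star lies on top of the relation and gives an isolated point, so that every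
-- basic open set is inhabited; an ideal without stars runs along an infinite
-- path.  Hence the space is discrete if there is no path, and otherwise every
-- path carries a gadget built from a few labels: one that is not T₁ over the
-- tree of F, one that is T₁ but not Hausdorff over the tree of H, and one that
-- is Hausdorff but not regular over the tree of M.  The space for p is the sum
-- of the three.
module Submission where

open import Defs
open import Axiom.ExcludedMiddle using (ExcludedMiddle)
open import Data.Empty using (⊥-elim)
open import Data.Fin using (Fin; zero; suc; #_; toℕ)
open import Data.Fin.Properties using (toℕ-injective)
open import Data.List using ([]; _∷_; _++_; applyUpTo)
open import Data.List.Properties using (applyUpTo-∷ʳ; ++-assoc; ++-identityʳ)
open import Data.Nat
open import Data.Nat.Properties
open import Data.Product using (Σ; ∃-syntax; _×_; _,_; proj₁; proj₂)
open import Data.Rational as ℚ using (ℚ; 0ℚ; 1ℚ)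
import Data.Rational.Properties as ℚ
open import Data.Sum using (_⊎_; inj₁; inj₂; [_,_]′)
open import Data.Vec using (Vec; []; _∷_; lookup; head; tail; tabulate; map)
open import Data.Vec.Properties using (tabulate∘lookup; lookup-map)
open import Data.Vec.Relation.Binary.Pointwise.Inductive as Pointwise using (Pointwise; []; _∷_)
open import Function using (_∘_; id; case_of_; _⇔_; mk⇔; Equivalence)
open import Function.Construct.Identity using (inverse)
open import Function.Metric.Structures using (IsGeneralMetric)
open import Level using (0ℓ)
open import Relation.Binary.Bundles using (Setoid)
open import Relation.Binary.Construct.Closure.Transitive using (TransClosure; [_]; _∷_)
open import Relation.Binary.Core using (Rel)
open import Relation.Binary.Definitions using (tri<; tri≈; tri>; Transitive)
open import Relation.Binary.PropositionalEquality
open import Relation.Binary.Structures using (IsPartialOrder)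
open import Relation.Nullary using (¬_; contradiction; Dec; yes; no)
open import Relation.Nullary.Decidable using (decidable-stable)
open import Relation.Unary using (Pred; _∈_; _∉_; _⊆_; Satisfiable)
open import Relation.Unary.Properties using (≐-refl; ≐-sym; ≐-trans)

open Equivalence using (to; from)
open ℝ

-- Overtness must hold uniformly in `p`, although it cannot be computed whether a node lies on an
-- infinite path. Hence every node, on its tree or not, gets a star above it, and a star is above
-- itself, so that its lower set is an ideal. A step between nodes lengthens the position strictly
-- and requires its upper end to be on the tree. So a node off the tree has only stars above it, and
-- a star-free ideal is forced along a path.
--
-- One relation carries all labels: the label selects the tree, and the gadgets share their stars.
-- The inclusions between the three sets keep the gadgets from interfering: `p ∈ F` excludes paths
-- for labels below 2, `p ∈ H` for labels below 4, `p ∈ M` for all labels. Each positive property is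
-- proved from the absence of paths with small labels, whatever the larger labels do.
--
-- The delicate gadget is that of label 4. Each neighbourhood of its point has to come close to the
-- points `5 + b` for all but finitely many `b`, and yet some neighbourhood has to avoid any given
-- one. The condition that the position be at most `b` does both, since positions are unbounded
-- along a path.

private variable
  k m   : ℕ
  F G N : Vec ℕ k → ℕ
  h     : Vec ℕ k → Vec ℕ m
  A B   : Vec ℕ k → Set

-- The inverse of the pairing function

triangle-mono : ∀ {a b} → a ≤ b → triangle a ≤ triangle b
triangle-mono z≤n       = z≤n
triangle-mono (s≤s a≤b) = +-mono-≤ (s≤s a≤b) (triangle-mono a≤b)

triangle-unique : ∀ {a b z} → triangle a ≤ z → z < triangle (suc a) →
                  triangle b ≤ z → z < triangle (suc b) → a ≡ b
triangle-unique {a} {b} ta az tb bz with <-cmp a b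
... | tri< a<b _ _ = contradiction (≤-trans (triangle-mono a<b) tb) (<⇒≱ az)
... | tri≈ _ a≡b _ = a≡b
... | tri> _ _ b<a = contradiction (≤-trans (triangle-mono b<a) ta) (<⇒≱ bz)

opaque
  -- The index of the diagonal containing `z`. It grows by 1 exactly when `suc z` reaches the next
  -- triangular number; truncated subtraction expresses this test, so that the definition is
  -- primitive recursive as it stands.
  root : ℕ → ℕ
  root zero    = 0
  root (suc z) = root z + (1 ∸ (triangle (suc (root z)) ∸ suc z))

  π₁ π₂ : ℕ → ℕ
  π₂ z = z ∸ triangle (root z)
  π₁ z = root z ∸ π₂ z

  root-bounds : ∀ z → triangle (root z) ≤ z × z < triangle (suc (root z))
  root-bounds zero    = z≤n , s≤s z≤n
  root-bounds (suc z) with triangle (suc (root z)) ≤? suc z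
  ... | yes t≤ rewrite m≤n⇒m∸n≡0 t≤ | +-comm (root z) 1 =
    t≤ , ≤-<-trans (proj₂ (root-bounds z)) (m<n+m (triangle (suc (root z))) {suc (suc (root z))} (s≤s z≤n))
  ... | no t≰ rewrite m≤n⇒m∸n≡0 (m<n⇒0<n∸m (≰⇒> t≰)) | +-identityʳ (root z) =
    m≤n⇒m≤1+n (proj₁ (root-bounds z)) , ≰⇒> t≰

  root-⟨⟩ : ∀ i j → root ⟨ i , j ⟩ ≡ i + j
  root-⟨⟩ i j = triangle-unique (proj₁ (root-bounds ⟨ i , j ⟩)) (proj₂ (root-bounds ⟨ i , j ⟩))
    (m≤m+n (triangle (i + j)) j)
    (subst (⟨ i , j ⟩ <_) (+-comm (triangle (i + j)) (suc (i + j)))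
      (+-monoʳ-< (triangle (i + j)) (s≤s (m≤n+m j i))))

  π₂-⟨⟩ : ∀ i j → π₂ ⟨ i , j ⟩ ≡ j
  π₂-⟨⟩ i j rewrite root-⟨⟩ i j = m+n∸m≡n (triangle (i + j)) j

  π₁-⟨⟩ : ∀ i j → π₁ ⟨ i , j ⟩ ≡ i
  π₁-⟨⟩ i j rewrite π₂-⟨⟩ i j | root-⟨⟩ i j = m+n∸n≡m i j

  π₂≤root : ∀ z → π₂ z ≤ root z
  π₂≤root z = s≤s⁻¹ (m<n+o⇒m∸n<o z (triangle (root z))
    (subst (z <_) (+-comm (suc (root z)) (triangle (root z))) (proj₂ (root-bounds z))))

  ⟨⟩-π : ∀ z → ⟨ π₁ z , π₂ z ⟩ ≡ z
  ⟨⟩-π z rewrite m∸n+n≡m (π₂≤root z) = m+[n∸m]≡n (proj₁ (root-bounds z))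

⟨⟩-injective : ∀ i j i′ j′ → ⟨ i , j ⟩ ≡ ⟨ i′ , j′ ⟩ → i ≡ i′ × j ≡ j′
⟨⟩-injective i j i′ j′ eq =
  trans (sym (π₁-⟨⟩ i j)) (trans (cong π₁ eq) (π₁-⟨⟩ i′ j′)) ,
  trans (sym (π₂-⟨⟩ i j)) (trans (cong π₂ eq) (π₂-⟨⟩ i′ j′))

-- Gödel numbers

tag : Rec k → ℕ
tag zero       = 0
tag suc        = 1
tag (proj _)   = 2
tag (comp _ _) = 3
tag (prec _ _) = 4
tag (mu _)     = 5

π₁-code : (c : Rec k) → π₁ (code c) ≡ tag c
π₁-code zero            = π₁-⟨⟩ 0 0
π₁-code suc             = π₁-⟨⟩ 1 0
π₁-code (proj i)        = π₁-⟨⟩ 2 (toℕ i)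
π₁-code (comp {m} f gs) = π₁-⟨⟩ 3 ⟨ m , ⟨ code f , codes gs ⟩ ⟩
π₁-code (prec f g)      = π₁-⟨⟩ 4 ⟨ code f , code g ⟩
π₁-code (mu f)          = π₁-⟨⟩ 5 (code f)

code-injective  : (c d : Rec k) → code c ≡ code d → c ≡ d
codes-injective : (cs ds : Vec (Rec k) m) → codes cs ≡ codes ds → cs ≡ ds
-- Equality of tags discards all pairs of different head constructors, so only the diagonal cases
-- remain.
same-tag        : (c d : Rec k) → tag c ≡ tag d → code c ≡ code d → c ≡ d

code-injective c d eq =
  same-tag c d (trans (sym (π₁-code c)) (trans (cong π₁ eq) (π₁-code d))) eq

same-tag zero zero refl _ = refl
same-tag suc suc refl _ = refl
same-tag (proj i) (proj j) refl eq =
  cong proj (toℕ-injective (proj₂ (⟨⟩-injective 2 (toℕ i) 2 (toℕ j) eq)))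
same-tag (comp {m} f gs) (comp {m′} f′ gs′) refl eq
  with m≡m′ , eq′ ← ⟨⟩-injective m ⟨ code f , codes gs ⟩ m′ ⟨ code f′ , codes gs′ ⟩
    (proj₂ (⟨⟩-injective 3 ⟨ m , ⟨ code f , codes gs ⟩ ⟩ 3 ⟨ m′ , ⟨ code f′ , codes gs′ ⟩ ⟩ eq))
  with refl ← m≡m′
  with f≡ , gs≡ ← ⟨⟩-injective (code f) (codes gs) (code f′) (codes gs′) eq′ =
    cong₂ comp (code-injective f f′ f≡) (codes-injective gs gs′ gs≡)
same-tag (prec f g) (prec f′ g′) refl eq
  with f≡ , g≡ ← ⟨⟩-injective (code f) (code g) (code f′) (code g′)
    (proj₂ (⟨⟩-injective 4 ⟨ code f , code g ⟩ 4 ⟨ code f′ , code g′ ⟩ eq)) =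
    cong₂ prec (code-injective f f′ f≡) (code-injective g g′ g≡)
same-tag (mu f) (mu f′) refl eq =
  cong mu (code-injective f f′ (proj₂ (⟨⟩-injective 5 (code f) 5 (code f′) eq)))

codes-injective []       []       _  = refl
codes-injective (c ∷ cs) (d ∷ ds) eq
  with c≡ , cs≡ ← ⟨⟩-injective (code c) (codes cs) (code d) (codes ds) eq =
    cong₂ _∷_ (code-injective c d c≡) (codes-injective cs ds cs≡)

-- Total recursive functions

Total : (Vec ℕ k → ℕ) → Set
Total {k} F = Σ (Rec k) λ c → ∀ xs → c [ xs ]⇓ F xs

record Totals (h : Vec ℕ k → Vec ℕ m) : Set where
  constructor totals
  field component : ∀ i → Total (λ xs → lookup (h xs) i)
open Totals

Computable₂ : (ℕ → ℕ → ℕ) → Set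
Computable₂ f = Σ (Rec 2) λ c → ∀ m n → c [ m ∷ n ∷ [] ]⇓ f m n

Total-ext : (∀ xs → F xs ≡ G xs) → Total F → Total G
Total-ext eq (c , c⇓) = c , λ xs → subst (c [ xs ]⇓_) (eq xs) (c⇓ xs)

infixr 5 _∷ᵗ_

[]ᵗ : Totals {k} (λ _ → [])
[]ᵗ = totals λ ()

_∷ᵗ_ : Total F → Totals h → Totals (λ xs → F xs ∷ h xs)
f ∷ᵗ hs = totals λ { zero → f ; (suc i) → component hs i }

var : (i : Fin k) → Total (λ xs → lookup xs i)
var i = proj i , λ _ → ⇓proj i

idᵗ : Totals {k} id
idᵗ = totals var

tailᵗ : Totals h → Totals (tail ∘ h)
tailᵗ {h = h} hs = totals λ i → Total-ext (λ xs → lookup-tail i (h xs)) (component hs (suc i))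
  where
  lookup-tail : ∀ i v → lookup v (suc i) ≡ lookup (tail v) i
  lookup-tail i (_ ∷ _) = refl

⇓projections : {h : Vec ℕ k → Vec ℕ m} (hs : Totals h) → ∀ xs →
  Pointwise (λ g y → g [ xs ]⇓ y) (tabulate (proj₁ ∘ component hs)) (h xs)
⇓projections {h = h} hs xs = subst (Pointwise _ (tabulate (proj₁ ∘ component hs))) (tabulate∘lookup (h xs))
  (Pointwise.tabulate⁺ (λ i → proj₂ (component hs i) xs))

compose : Total F → Totals h → Total (F ∘ h)
compose {h = h} (c , c⇓) hs = comp c (tabulate (proj₁ ∘ component hs)) , λ xs →
  ⇓comp (⇓projections {h = h} hs xs) (c⇓ (h xs))

recur : ℕ → ℕ → (ℕ → ℕ → ℕ) → ℕ
recur zero    b s = b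
recur (suc n) b s = s n (recur n b s)

recursion : {B : Vec ℕ k → ℕ} {S : Vec ℕ (2 + k) → ℕ} → Total N → Total B → Total S →
            Total (λ xs → recur (N xs) (B xs) (λ i r → S (i ∷ r ∷ xs)))
recursion {B = B} {S} n (b , b⇓) (s , s⇓) =
  compose {F = λ ys → recur (head ys) (B (tail ys)) (λ i r → S (i ∷ r ∷ tail ys))}
    (prec b s , λ { (n ∷ xs) → iterate n xs }) (n ∷ᵗ idᵗ)
  where
  iterate : ∀ n xs → prec b s [ n ∷ xs ]⇓ recur n (B xs) (λ i r → S (i ∷ r ∷ xs))
  iterate zero    xs = ⇓prec-zero (b⇓ xs)
  iterate (suc n) xs = ⇓prec-suc (iterate n xs) (s⇓ _)

constᵗ : ∀ n → Total {k} (λ _ → n)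
constᵗ zero    = zero , λ _ → ⇓zero
constᵗ (suc n) with c , c⇓ ← constᵗ n = comp suc (c ∷ []) , λ xs → ⇓comp (c⇓ xs ∷ []) ⇓suc

lift₁ : ∀ {f} → Computable f → Total F → Total (λ xs → f (F xs))
lift₁ {f = f} (c , c⇓) t =
  compose {F = λ ys → f (head ys)} (c , λ { (n ∷ []) → c⇓ n }) (t ∷ᵗ []ᵗ)

lift₂ : ∀ {f} → Computable₂ f → Total F → Total G → Total (λ xs → f (F xs) (G xs))
lift₂ {f = f} (c , c⇓) t u = compose {F = λ ys → f (head ys) (head (tail ys))}
  (c , λ { (m ∷ n ∷ []) → c⇓ m n }) (t ∷ᵗ u ∷ᵗ []ᵗ)

computable : ∀ {f} → Total F → (∀ n → F (n ∷ []) ≡ f n) → Computable f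
computable (c , c⇓) eq = c , λ n → subst (c [ _ ]⇓_) (eq n) (c⇓ _)

computable₂ : ∀ {f} → Total F → (∀ m n → F (m ∷ n ∷ []) ≡ f m n) → Computable₂ f
computable₂ (c , c⇓) eq = c , λ m n → subst (c [ _ ]⇓_) (eq m n) (c⇓ _)

suc-computable : Computable suc
suc-computable = suc , λ _ → ⇓suc

pred-computable : Computable pred
pred-computable = computable (recursion (var (# 0)) (constᵗ 0) (var (# 0)))
  λ { zero → refl ; (suc _) → refl }

+-computable : Computable₂ _+_
+-computable = computable₂ (recursion (var (# 0)) (var (# 1)) (lift₁ suc-computable (var (# 1)))) go
  where
  go : ∀ m n → recur m n (λ _ r → suc r) ≡ m + n
  go zero    n = refl
  go (suc m) n = cong suc (go m n)

*-computable : Computable₂ _*_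
*-computable =
  computable₂ (recursion (var (# 0)) (constᵗ 0) (lift₂ +-computable (var (# 3)) (var (# 1)))) go
  where
  go : ∀ m n → recur m 0 (λ _ r → n + r) ≡ m * n
  go zero    n = refl
  go (suc m) n = cong (n +_) (go m n)

∸-computable : Computable₂ _∸_
∸-computable = computable₂ (recursion (var (# 1)) (var (# 0)) (lift₁ pred-computable (var (# 1)))) go
  where
  go : ∀ m n → recur n m (λ _ r → pred r) ≡ m ∸ n
  go m zero    = refl
  go m (suc n) = trans (cong pred (go m n)) (pred[m∸n]≡m∸[1+n] m n)

triangle-computable : Computable triangle
triangle-computable = computable (recursion (var (# 0)) (constᵗ 0)
  (lift₂ +-computable (lift₁ suc-computable (var (# 0))) (var (# 1)))) go
  where
  go : ∀ n → recur n 0 (λ i r → suc i + r) ≡ triangle n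
  go zero    = refl
  go (suc n) = cong (suc n +_) (go n)

⟨⟩-computable : Computable₂ ⟨_,_⟩
⟨⟩-computable = computable₂
  (lift₂ +-computable
    (lift₁ triangle-computable (lift₂ +-computable (var (# 0)) (var (# 1)))) (var (# 1)))
  λ _ _ → refl

opaque
  unfolding root

  root-computable : Computable root
  root-computable = computable (recursion (var (# 0)) (constᵗ 0)
    (lift₂ +-computable (var (# 1))
      (lift₂ ∸-computable (constᵗ 1)
        (lift₂ ∸-computable (lift₁ triangle-computable (lift₁ suc-computable (var (# 1))))
          (lift₁ suc-computable (var (# 0))))))) go
    where
    go : ∀ n → recur n 0 (λ i r → r + (1 ∸ (triangle (suc r) ∸ suc i))) ≡ root n
    go zero    = refl
    go (suc n) = cong (λ r → r + (1 ∸ (triangle (suc r) ∸ suc n))) (go n)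

  π₂-computable : Computable π₂
  π₂-computable = computable (lift₂ ∸-computable (var (# 0))
    (lift₁ triangle-computable (lift₁ root-computable (var (# 0))))) λ _ → refl

  π₁-computable : Computable π₁
  π₁-computable = computable
    (lift₂ ∸-computable (lift₁ root-computable (var (# 0))) (lift₁ π₂-computable (var (# 0))))
    λ _ → refl

-- An evaluator with bounded search

cond : ℕ → ℕ → ℕ
cond zero    _ = 0
cond (suc _) v = v

guard : Vec ℕ m → ℕ → ℕ
guard []       v = v
guard (u ∷ us) v = cond u (guard us v)

-- The state of a search: 0 while searching, 1 when stuck at an undefined
-- value, 2 + i once the zero i has been found.
search : (ℕ → ℕ) → ℕ → ℕ → ℕ
search f i (suc r) = suc r
search f i zero with f i
... | 0           = 1
... | 1           = 2 + i
... | suc (suc _) = 0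

-- Only searches are bounded by s.  The value 0 stands for "undefined", suc y
-- for the value y.
run  : Rec k → ℕ → Vec ℕ k → ℕ
runs : Vec (Rec k) m → ℕ → Vec ℕ k → Vec ℕ m

run zero        s xs       = 1
run suc         s (x ∷ []) = suc (suc x)
run (proj i)    s xs       = suc (lookup xs i)
run (comp f gs) s xs       = guard (runs gs s xs) (run f s (map pred (runs gs s xs)))
run (prec f g)  s (n ∷ xs) = recur n (run f s xs) λ i r → cond r (run g s (i ∷ pred r ∷ xs))
-- `pred` makes both 0 and 1, searching and stuck, into "undefined", and the state `2 + i` into the
-- value `i`.
run (mu f)      s xs       = pred (recur s 0 (search λ i → run f s (i ∷ xs)))

runs []       s xs = []
runs (g ∷ gs) s xs = run g s xs ∷ runs gs s xs

cond-suc : ∀ u v {y} → cond u v ≡ suc y → ∃[ u′ ] u ≡ suc u′ × v ≡ suc y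
cond-suc (suc u′) v eq = u′ , refl , eq

run-sound  : (c : Rec k) → ∀ s xs {y} → run c s xs ≡ suc y → c [ xs ]⇓ y
runs-sound : (gs : Vec (Rec k) m) → ∀ s xs v {z} → guard (runs gs s xs) v ≡ suc z →
             Pointwise (λ g y → g [ xs ]⇓ y) gs (map pred (runs gs s xs)) × v ≡ suc z

run-sound zero        s xs       refl = ⇓zero
run-sound suc         s (x ∷ []) refl = ⇓suc
run-sound (proj i)    s xs       refl = ⇓proj i
run-sound (comp f gs) s xs       eq
  with gs⇓ , f≡ ← runs-sound gs s xs _ eq = ⇓comp gs⇓ (run-sound f s _ f≡)
run-sound (prec f g)  s (n ∷ xs) eq = go n eq
  where
  go : ∀ n {y} → run (prec f g) s (n ∷ xs) ≡ suc y → prec f g [ n ∷ xs ]⇓ y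
  go zero    eq = ⇓prec-zero (run-sound f s xs eq)
  go (suc n) eq with u , n≡ , g≡ ← cond-suc _ _ eq =
    ⇓prec-suc (go n n≡)
      (run-sound g s _ (trans (cong (λ r → run g s (n ∷ r ∷ xs)) (sym (cong pred n≡))) g≡))
run-sound {k} (mu f) s xs {y} eq = found s (pred-suc _ eq)
  where
  value : ℕ → ℕ
  value i = run f s (i ∷ xs)

  state : ℕ → ℕ
  state j = recur j 0 (search value)

  pred-suc : ∀ n → pred n ≡ suc y → n ≡ 2 + y
  pred-suc (suc (suc _)) refl = refl

  searching : ∀ j → state j ≡ 0 → ∀ {i} → i < j → ∃[ y ] f [ i ∷ xs ]⇓ suc y
  searching (suc j) eq i<1+j with state j in eqⱼ | eq
  ... | zero | eq′ with value j in v | eq′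
  ...   | suc (suc y) | _ with m≤n⇒m<n∨m≡n (s≤s⁻¹ i<1+j)
  ...     | inj₁ i<j  = searching j eqⱼ i<j
  ...     | inj₂ refl = y , run-sound f s (j ∷ xs) v

  found : ∀ j → state j ≡ 2 + y → mu f [ xs ]⇓ y
  found (suc j) eq with state j in eqⱼ | eq
  ... | suc _ | refl = found j eqⱼ
  ... | zero  | eq′ with value j in v | eq′
  ...   | 1 | refl = ⇓mu (run-sound f s (j ∷ xs) v) (searching j eqⱼ)

runs-sound []       s xs v eq = [] , eq
runs-sound (g ∷ gs) s xs v eq
  with u , g≡ , eq′ ← cond-suc (run g s xs) _ eq
  with gs⇓ , v≡ ← runs-sound gs s xs v eq′ =
    run-sound g s xs (trans g≡ (cong suc (sym (cong pred g≡)))) ∷ gs⇓ , v≡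

-- Completeness is stated for all large bounds rather than for some bound: the bounds of
-- subcomputations then combine by maximum, without showing that `run` is monotone.
Eventually : (ℕ → Set) → Set
Eventually P = ∃[ s₀ ] ∀ s → s₀ ≤ s → P s

always : ∀ {P : ℕ → Set} → (∀ s → P s) → Eventually P
always p = 0 , λ s _ → p s

eventually-map₂ : ∀ {P Q R : ℕ → Set} → (∀ s → P s → Q s → R s) →
                  Eventually P → Eventually Q → Eventually R
eventually-map₂ f (a , p) (b , q) =
  a ⊔ b , λ s ≤s → f s (p s (m⊔n≤o⇒m≤o a b ≤s)) (q s (m⊔n≤o⇒n≤o a b ≤s))

eventually-all : ∀ {P : ℕ → ℕ → Set} n → (∀ {i} → i < n → Eventually (P i)) →
                 Eventually (λ s → ∀ {i} → i < n → P i s)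
eventually-all zero    _ = always λ _ ()
eventually-all {P} (suc n) p = eventually-map₂ extend
  (eventually-all {P} n (λ i<n → p (m≤n⇒m≤1+n i<n))) (p ≤-refl)
  where
  extend : ∀ s → (∀ {i} → i < n → P i s) → P n s → ∀ {i} → i < suc n → P i s
  extend s below at i<1+n with m≤n⇒m<n∨m≡n (s≤s⁻¹ i<1+n)
  ... | inj₁ i<n  = below i<n
  ... | inj₂ refl = at

run-complete  : (c : Rec k) → ∀ xs {y} → c [ xs ]⇓ y → Eventually (λ s → run c s xs ≡ suc y)
runs-complete : (gs : Vec (Rec k) m) → ∀ xs {ys} → Pointwise (λ g y → g [ xs ]⇓ y) gs ys →
                Eventually (λ s → runs gs s xs ≡ map suc ys)

guard-suc : ∀ (ys : Vec ℕ m) v → guard (map suc ys) v ≡ v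
guard-suc []       v = refl
guard-suc (y ∷ ys) v = guard-suc ys v

map-pred-suc : ∀ (ys : Vec ℕ m) → map pred (map suc ys) ≡ ys
map-pred-suc []       = refl
map-pred-suc (y ∷ ys) = cong (y ∷_) (map-pred-suc ys)

run-complete zero        xs ⇓zero = always λ _ → refl
run-complete suc         (_ ∷ []) ⇓suc = always λ _ → refl
run-complete (proj i)    xs (⇓proj i) = always λ _ → refl
run-complete (comp f gs) xs (⇓comp {ys = ys} gs⇓ f⇓) =
  eventually-map₂ compute (runs-complete gs xs gs⇓) (run-complete f ys f⇓)
  where
  compute : ∀ s → runs gs s xs ≡ map suc ys → run f s ys ≡ suc _ → run (comp f gs) s xs ≡ suc _
  compute s gs≡ f≡ rewrite gs≡ | map-pred-suc ys = trans (guard-suc ys _) f≡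
run-complete (prec f g) (n ∷ xs) d = go n d
  where
  go : ∀ n {y} → prec f g [ n ∷ xs ]⇓ y → Eventually (λ s → run (prec f g) s (n ∷ xs) ≡ suc y)
  go zero    (⇓prec-zero f⇓) = run-complete f xs f⇓
  go (suc n) (⇓prec-suc {y = y} {z = z} n⇓ g⇓) =
    eventually-map₂ compute (go n n⇓) (run-complete g (n ∷ y ∷ xs) g⇓)
    where
    compute : ∀ s → run (prec f g) s (n ∷ xs) ≡ suc y → run g s (n ∷ y ∷ xs) ≡ suc z →
              run (prec f g) s (suc n ∷ xs) ≡ suc z
    compute s n≡ g≡ rewrite n≡ = g≡
run-complete (mu f) xs {n} (⇓mu f⇓ below) = eventually-map₂ compute
  (eventually-map₂ (λ _ → _,_) (run-complete f (n ∷ xs) f⇓)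
    (eventually-all n λ i<n → let y , i⇓ = below i<n in
      eventually-map₂ (λ _ p _ → y , p) (run-complete f _ i⇓) (0 , λ s _ → s)))
  -- With bound `s` only the candidates below `s` are tested, so `s` has to exceed `n`.
  (suc n , λ _ n<s → n<s)
  where
  compute : ∀ s → run f s (n ∷ xs) ≡ 1 × (∀ {i} → i < n → ∃[ y ] run f s (i ∷ xs) ≡ 2 + y) →
            n < s → run (mu f) s xs ≡ suc n
  compute s (at , before) n<s =
    cong pred (trans (cong state (sym (m∸n+n≡m n<s))) (found (s ∸ suc n)))
    where
    value : ℕ → ℕ
    value i = run f s (i ∷ xs)

    state : ℕ → ℕ
    state j = recur j 0 (search value)

    searching : ∀ j → j ≤ n → state j ≡ 0
    searching zero    _   = refl
    searching (suc j) j<n with y , v ← before j<n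
      rewrite searching j (<⇒≤ j<n) | v = refl

    found : ∀ j → state (j + suc n) ≡ 2 + n
    found zero    rewrite searching n ≤-refl | at = refl
    found (suc j) rewrite found j = refl

runs-complete []       xs []         = always λ _ → refl
runs-complete (g ∷ gs) xs (g⇓ ∷ gs⇓) =
  eventually-map₂ (λ _ → cong₂ _∷_) (run-complete g xs g⇓) (runs-complete gs xs gs⇓)

-- At a sufficiently large bound the function `run` returns both values.
⇓-deterministic : (c : Rec k) → ∀ xs {y z} → c [ xs ]⇓ y → c [ xs ]⇓ z → y ≡ z
⇓-deterministic c xs y⇓ z⇓
  with s , eq ← eventually-map₂ (λ _ p q → suc-injective (trans (sym p) q))
                  (run-complete c xs y⇓) (run-complete c xs z⇓) = eq s ≤-refl

cond-computable : Computable₂ cond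
cond-computable = computable₂ (recursion (var (# 0)) (constᵗ 0) (var (# 3)))
  λ { zero _ → refl ; (suc _) _ → refl }

runᵗ  : (c : Rec k) → Total (λ ys → run c (head ys) (tail ys))
runsᵗ : (gs : Vec (Rec k) m) → Totals (λ ys → runs gs (head ys) (tail ys))

guardᵗ : ∀ {m} {h : Vec ℕ k → Vec ℕ m} → Totals h → Total F → Total (λ xs → guard (h xs) (F xs))
guardᵗ {m = zero}  {h = h} hs t = Total-ext (λ xs → lemma (h xs)) t
  where
  lemma : ∀ us {v} → v ≡ guard us v
  lemma [] = refl
guardᵗ {m = suc m} {h = h} hs t =
  Total-ext (λ xs → lemma (h xs))
    (lift₂ cond-computable (component hs zero) (guardᵗ (tailᵗ hs) t))
  where
  lemma : ∀ us {v} → cond (lookup us zero) (guard (tail us) v) ≡ guard us v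
  lemma (_ ∷ _) = refl

mapᵗ : ∀ {f} → Computable f → Totals h → Totals (λ xs → map f (h xs))
mapᵗ {h = h} {f} c hs = totals λ i → Total-ext (λ xs → sym (lookup-map i f (h xs)))
  (lift₁ c (component hs i))

headᵗ : Total {suc k} head
headᵗ = Total-ext (λ { (_ ∷ _) → refl }) (var zero)

searchᵗ : {V : Vec ℕ (suc k) → ℕ} → Total V →
          Total {2 + k} (λ ys → search (λ i → V (i ∷ tail (tail ys))) (head ys) (head (tail ys)))
searchᵗ {V = V} v = Total-ext
  (λ { (i ∷ r ∷ xs) → lemma (λ i → V (i ∷ xs)) i r })
  -- A recursion whose step ignores the previous value is a case distinction, with the predecessor
  -- at hand in the nonzero case.
  (recursion (var (# 1))
    (recursion (compose v (var (# 0) ∷ᵗ tailᵗ (tailᵗ idᵗ))) (constᵗ 1)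
      (recursion (var (# 0)) (lift₁ suc-computable (lift₁ suc-computable (var (# 2)))) (constᵗ 0)))
    (lift₁ suc-computable (var (# 0))))
  where
  lemma : ∀ f i r → recur r (recur (f i) 1 (λ u _ → recur u (2 + i) (λ _ _ → 0))) (λ u _ → suc u)
          ≡ search f i r
  lemma f i (suc r) = refl
  lemma f i zero with f i
  ... | 0           = refl
  ... | 1           = refl
  ... | suc (suc _) = refl

runᵗ zero        = constᵗ 1
runᵗ suc         = Total-ext (λ { (s ∷ x ∷ []) → refl })
  (lift₁ suc-computable (lift₁ suc-computable (var (# 1))))
runᵗ (proj i)    = lift₁ suc-computable (component (tailᵗ idᵗ) i)
runᵗ (comp f gs) = guardᵗ (runsᵗ gs)
  (compose (runᵗ f) (headᵗ ∷ᵗ mapᵗ pred-computable (runsᵗ gs)))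
runᵗ (prec f g)  = Total-ext (λ { (s ∷ n ∷ xs) → refl })
  (recursion (var (# 1)) (compose (runᵗ f) (var (# 0) ∷ᵗ tailᵗ (tailᵗ idᵗ)))
    (lift₂ cond-computable (var (# 1))
      (compose (runᵗ g)
        (var (# 2) ∷ᵗ var (# 0) ∷ᵗ lift₁ pred-computable (var (# 1)) ∷ᵗ
          tailᵗ (tailᵗ (tailᵗ (tailᵗ idᵗ)))))))
runᵗ (mu f)      = Total-ext (λ { (s ∷ xs) → refl })
  (lift₁ pred-computable (recursion (var (# 0)) (constᵗ 0)
    (searchᵗ (compose (runᵗ f) (var (# 1) ∷ᵗ var (# 0) ∷ᵗ tailᵗ (tailᵗ idᵗ))))))

runsᵗ []       = totals λ ()
runsᵗ (g ∷ gs) = runᵗ g ∷ᵗ runsᵗ gs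

-- Decidable relations

-- A characteristic function takes the value 0 where the relation holds.
Recursive : (Vec ℕ k → Set) → Set
Recursive {k} A = Σ (Vec ℕ k → ℕ) λ F → Total F × (∀ xs → A xs ⇔ F xs ≡ 0)

Recursive-⇔ : (∀ xs → A xs ⇔ B xs) → Recursive A → Recursive B
Recursive-⇔ eq (F , t , A⇔) = F , t , λ xs →
  mk⇔ (to (A⇔ xs) ∘ from (eq xs)) (to (eq xs) ∘ from (A⇔ xs))

composeʳ : Recursive A → Totals h → Recursive (A ∘ h)
composeʳ {h = h} (F , t , A⇔) hs = F ∘ h , compose t hs , λ xs → A⇔ (h xs)

infix  4 _≤ʳ_ _≡ʳ_
infixr 2 _×ʳ_
infixr 1 _⊎ʳ_
infixr 0 _→ʳ_

_≤ʳ_ : Total F → Total G → Recursive (λ xs → F xs ≤ G xs)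
f ≤ʳ g = _ , lift₂ ∸-computable f g , λ _ → mk⇔ m≤n⇒m∸n≡0 (m∸n≡0⇒m≤n)

_×ʳ_ : Recursive A → Recursive B → Recursive (λ xs → A xs × B xs)
(F , f , A⇔) ×ʳ (G , g , B⇔) = _ , lift₂ +-computable f g , λ xs → mk⇔
  (λ (a , b) → cong₂ _+_ (to (A⇔ xs) a) (to (B⇔ xs) b))
  (λ eq → from (A⇔ xs) (m+n≡0⇒m≡0 (F xs) eq) , from (B⇔ xs) (m+n≡0⇒n≡0 (F xs) eq))

_⊎ʳ_ : Recursive A → Recursive B → Recursive (λ xs → A xs ⊎ B xs)
(F , f , A⇔) ⊎ʳ (G , g , B⇔) = _ , lift₂ *-computable f g , λ xs → mk⇔
  (λ { (inj₁ a) → cong (_* G xs) (to (A⇔ xs) a)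
     ; (inj₂ b) → trans (cong (F xs *_) (to (B⇔ xs) b)) (*-zeroʳ (F xs)) })
  (λ eq → [ inj₁ ∘ from (A⇔ xs) , inj₂ ∘ from (B⇔ xs) ]′ (m*n≡0⇒m≡0∨n≡0 (F xs) eq))

_→ʳ_ : Recursive A → Recursive B → Recursive (λ xs → A xs → B xs)
(F , f , A⇔) →ʳ (G , g , B⇔) = _ , lift₂ *-computable (lift₂ ∸-computable (constᵗ 1) f) g ,
  λ xs → mk⇔
    (λ imp → implies (F xs) (to (B⇔ xs) ∘ imp ∘ from (A⇔ xs)))
    (λ eq → from (B⇔ xs) ∘ implied (F xs) eq ∘ to (A⇔ xs))
  where
  implies : ∀ u {v} → (u ≡ 0 → v ≡ 0) → (1 ∸ u) * v ≡ 0
  implies zero    {v} imp = trans (+-identityʳ v) (imp refl)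
  implies (suc u) {v} imp = cong (_* v) (0∸n≡0 u)
  implied : ∀ u {v} → (1 ∸ u) * v ≡ 0 → u ≡ 0 → v ≡ 0
  implied _ {v} eq refl = trans (sym (+-identityʳ v)) eq

_≡ʳ_ : Total F → Total G → Recursive (λ xs → F xs ≡ G xs)
f ≡ʳ g = Recursive-⇔
  (λ _ → mk⇔ (λ (a , b) → ≤-antisym a b) (λ eq → ≤-reflexive eq , ≤-reflexive (sym eq)))
  (f ≤ʳ g ×ʳ g ≤ʳ f)

∀≤ʳ : Total N → Recursive A → Recursive (λ xs → ∀ {i} → i ≤ N xs → A (i ∷ xs))
∀≤ʳ {N = N} {A = A} n (F , f , A⇔) = _ ,
  recursion (lift₁ suc-computable n) (constᵗ 0)
    (lift₂ +-computable (compose f (var (# 0) ∷ᵗ tailᵗ (tailᵗ idᵗ))) (var (# 1))) ,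
  λ xs → mk⇔ (forth xs) λ eq i≤ → from (A⇔ _) (terms≡0 xs (suc (N xs)) eq (s≤s i≤))
  where
  sum≡0 : ∀ xs n → (∀ {i} → i < n → F (i ∷ xs) ≡ 0) → recur n 0 (λ i r → F (i ∷ xs) + r) ≡ 0
  sum≡0 xs zero    _   = refl
  sum≡0 xs (suc n) all = cong₂ _+_ (all ≤-refl) (sum≡0 xs n (all ∘ m≤n⇒m≤1+n))
  forth : ∀ xs → (∀ {i} → i ≤ N xs → A (i ∷ xs)) → recur (suc (N xs)) 0 (λ i r → F (i ∷ xs) + r) ≡ 0
  forth xs all = sum≡0 xs (suc (N xs)) λ i< → to (A⇔ _) (all (s≤s⁻¹ i<))
  terms≡0 : ∀ xs n → recur n 0 (λ i r → F (i ∷ xs) + r) ≡ 0 → ∀ {i} → i < n → F (i ∷ xs) ≡ 0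
  terms≡0 xs (suc n) eq i< with m≤n⇒m<n∨m≡n (s≤s⁻¹ i<)
  ... | inj₁ i<n  = terms≡0 xs n (m+n≡0⇒n≡0 (F (n ∷ xs)) eq) i<n
  ... | inj₂ refl = m+n≡0⇒m≡0 (F (n ∷ xs)) eq

∃≤ʳ : Total N → Recursive A → Recursive (λ xs → ∃[ i ] (i ≤ N xs × A (i ∷ xs)))
∃≤ʳ {N = N} {A = A} n (F , f , A⇔) = _ ,
  recursion (lift₁ suc-computable n) (constᵗ 1)
    (lift₂ *-computable (compose f (var (# 0) ∷ᵗ tailᵗ (tailᵗ idᵗ))) (var (# 1))) ,
  λ xs → mk⇔ (λ (i , i≤ , a) → product≡0 xs (suc (N xs)) (s≤s i≤) (to (A⇔ _) a))
             (λ eq → let i , i< , z = factor≡0 xs (suc (N xs)) eq in i , s≤s⁻¹ i< , from (A⇔ _) z)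
  where
  product : Vec ℕ _ → ℕ → ℕ
  product xs n = recur n 1 (λ i r → F (i ∷ xs) * r)
  product≡0 : ∀ xs n {i} → i < n → F (i ∷ xs) ≡ 0 → product xs n ≡ 0
  product≡0 xs (suc n) i< eq with m≤n⇒m<n∨m≡n (s≤s⁻¹ i<)
  ... | inj₁ i<n  = trans (cong (F (n ∷ xs) *_) (product≡0 xs n i<n eq)) (*-zeroʳ (F (n ∷ xs)))
  ... | inj₂ refl = cong (_* product xs n) eq
  factor≡0 : ∀ xs n → product xs n ≡ 0 → ∃[ i ] (i < n × F (i ∷ xs) ≡ 0)
  factor≡0 xs (suc n) eq with m*n≡0⇒m≡0∨n≡0 (F (n ∷ xs)) eq
  ... | inj₁ z = n , ≤-refl , z
  ... | inj₂ p with i , i<n , z ← factor≡0 xs n p = i , m≤n⇒m≤1+n i<n , z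

-- The searched function ignores the search variable, so the search stops at 0 or never.
semidecide : Recursive A → Σ (Rec k) λ c → ∀ xs → A xs ⇔ (∃[ y ] c [ xs ]⇓ y)
semidecide {A = A} (F , t , A⇔) with c , c⇓ ← compose t (tailᵗ idᵗ) = mu c , λ xs → mk⇔
  (λ a → 0 , ⇓mu (subst (c [ 0 ∷ xs ]⇓_) (to (A⇔ xs) a) (c⇓ (0 ∷ xs))) λ ())
  (λ { (y , ⇓mu z _) → from (A⇔ xs) (⇓-deterministic c (y ∷ xs) (c⇓ (y ∷ xs)) z) })

-- Uniformly c.e. relations

numeral : ℕ → Rec k
numeral zero    = zero
numeral (suc n) = comp suc (numeral n ∷ [])

numeral⇓ : ∀ n {xs : Vec ℕ k} → numeral n [ xs ]⇓ n
numeral⇓ zero    = ⇓zero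
numeral⇓ (suc n) = ⇓comp (numeral⇓ n ∷ []) ⇓suc

-- The s-m-n construction: the first argument is built in as a numeral, whose Gödel number is
-- computable from it.
specialize : Rec 2 → ℕ → Rec 1
specialize c p = comp c (numeral p ∷ proj zero ∷ [])

specialize⇓ : ∀ c p x {y} → specialize c p [ x ∷ [] ]⇓ y ⇔ c [ p ∷ x ∷ [] ]⇓ y
specialize⇓ c p x = mk⇔ forth (λ d → ⇓comp (numeral⇓ p ∷ ⇓proj zero ∷ []) d)
  where
  forth : ∀ {y} → specialize c p [ x ∷ [] ]⇓ y → c [ p ∷ x ∷ [] ]⇓ y
  forth (⇓comp (p⇓ ∷ ⇓proj _ ∷ []) d)
    with refl ← ⇓-deterministic (numeral p) _ (numeral⇓ p) p⇓ = d

code-numeral-computable : Computable (λ n → code (numeral {1} n))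
code-numeral-computable = computable
  (recursion (var (# 0)) (constᵗ ⟨ 0 , 0 ⟩)
    (pairᵗ (constᵗ 3) (pairᵗ (constᵗ 1) (pairᵗ (constᵗ (code suc)) (pairᵗ (var (# 1)) (constᵗ 0))))))
  go
  where
  pairᵗ : ∀ {F G : Vec ℕ k → ℕ} → Total F → Total G → Total (λ xs → ⟨ F xs , G xs ⟩)
  pairᵗ = lift₂ ⟨⟩-computable
  go : ∀ n → recur n ⟨ 0 , 0 ⟩ (λ _ r → ⟨ 3 , ⟨ 1 , ⟨ code suc , ⟨ r , 0 ⟩ ⟩ ⟩ ⟩) ≡ code (numeral {1} n)
  go zero    = refl
  go (suc n) = cong (λ r → ⟨ 3 , ⟨ 1 , ⟨ code suc , ⟨ r , 0 ⟩ ⟩ ⟩ ⟩) (go n)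

code-specialize-computable : ∀ c → Computable (λ p → code (specialize c p))
code-specialize-computable c = computable
  (lift₂ ⟨⟩-computable (constᵗ 3) (lift₂ ⟨⟩-computable (constᵗ 2)
    (lift₂ ⟨⟩-computable (constᵗ (code c))
      (lift₂ ⟨⟩-computable (lift₁ code-numeral-computable (var (# 0)))
        (constᵗ ⟨ code {1} (proj zero) , 0 ⟩)))))
  λ _ → refl

W-code : ∀ (c : Rec 1) x → W (code c) x ⇔ (∃[ y ] c [ x ∷ [] ]⇓ y)
W-code c x = mk⇔ forth (λ d → c , refl , d)
  where
  forth : W (code c) x → ∃[ y ] c [ x ∷ [] ]⇓ y
  forth (c′ , eq , d) with refl ← code-injective c′ c eq = d

-- A semidecider for `A` that unpairs its second argument is specialized to `p`; the Gödel number of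
-- the result is the index.
index : {A : Vec ℕ 3 → Set} → Recursive A →
        Σ (ℕ → ℕ) λ g → Computable g × (∀ p i j → V (g p) i j ⇔ A (p ∷ i ∷ j ∷ []))
index {A} r
  with c , c⇔ ← semidecide (composeʳ r (var (# 0) ∷ᵗ lift₁ π₁-computable (var (# 1)) ∷ᵗ
                                         lift₁ π₂-computable (var (# 1)) ∷ᵗ []ᵗ)) =
  (λ p → code (specialize c p)) , code-specialize-computable c , λ p i j →
    let eq = cong₂ (λ i j → A (p ∷ i ∷ j ∷ [])) (π₁-⟨⟩ i j) (π₂-⟨⟩ i j)
        W⇔ = W-code (specialize c p) ⟨ i , j ⟩
        s⇔ = specialize⇓ c p ⟨ i , j ⟩
        A⇔ = c⇔ (p ∷ ⟨ i , j ⟩ ∷ [])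
    in mk⇔ (λ v → let y , d = to W⇔ v in subst id eq (from A⇔ (y , to s⇔ d)))
           (λ a → let y , d = to A⇔ (subst id (sym eq) a) in from W⇔ (y , from s⇔ d))

-- Finite sequences

-- Every number codes a finite sequence: 0 the empty one, and suc ⟨ x , c ⟩
-- the sequence coded by c followed by x (whereas codeSeq adds x in front).
parent : ℕ → ℕ
parent c = π₂ (pred c)

ancestor : ℕ → ℕ → ℕ
ancestor zero    c = c
ancestor (suc n) c = parent (ancestor n c)

infix 4 _⊑_ _⊏_

-- The last entry is outermost in a code, so prefixes are iterated parents and a proper prefix has a
-- smaller code; hence `<` can express properness.
_⊑_ _⊏_ : Rel ℕ 0ℓ
c ⊑ d = ∃[ n ] ancestor n d ≡ c
c ⊏ d = c < d × c ⊑ d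

initial : (ℕ → ℕ) → ℕ → ℕ
initial f zero    = 0
initial f (suc n) = suc ⟨ f n , initial f n ⟩

opaque
  unfolding π₂

  π₂-≤ : ∀ z → π₂ z ≤ z
  π₂-≤ z = m∸n≤m z (triangle (root z))

ancestor-≤ : ∀ n c → ancestor n c ≤ c ∸ n
ancestor-≤ zero    c = ≤-refl
ancestor-≤ (suc n) c = subst (parent (ancestor n c) ≤_) (pred[m∸n]≡m∸[1+n] c n)
  (≤-trans (π₂-≤ _) (pred-mono-≤ (ancestor-≤ n c)))

ancestor-+ : ∀ m n c → ancestor (m + n) c ≡ ancestor m (ancestor n c)
ancestor-+ zero    n c = refl
ancestor-+ (suc m) n c = cong parent (ancestor-+ m n c)

⊑-refl : ∀ {c} → c ⊑ c
⊑-refl = 0 , refl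

⊑-trans : ∀ {c d e} → c ⊑ d → d ⊑ e → c ⊑ e
⊑-trans (m , refl) (n , refl) = m + n , ancestor-+ m n _

⊑⇒≤ : ∀ {c d} → c ⊑ d → c ≤ d
⊑⇒≤ {d = d} (n , refl) = ≤-trans (ancestor-≤ n d) (m∸n≤m d n)

ancestor≡0 : ∀ {n d} → d ≤ n → ancestor n d ≡ 0
ancestor≡0 {n} {d} d≤n = n≤0⇒n≡0 (subst (ancestor n d ≤_) (m≤n⇒m∸n≡0 d≤n) (ancestor-≤ n d))

0⊑ : ∀ d → 0 ⊑ d
0⊑ d = d , ancestor≡0 {d} ≤-refl

-- This makes `⊑` decidable: after `d` steps the ancestor is 0 and stays 0, so further steps reach
-- nothing new.
⊑-bounded : ∀ {c d} → c ⊑ d → ∃[ n ] (n ≤ d × ancestor n d ≡ c)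
⊑-bounded {d = d} (n , eq) with ≤-total n d
... | inj₁ n≤d = n , n≤d , eq
... | inj₂ d≤n = d , ≤-refl , trans (ancestor≡0 {d} ≤-refl) (trans (sym (ancestor≡0 d≤n)) eq)

⊑-comparable : ∀ {c d e} → c ⊑ e → d ⊑ e → c ≤ d → c ⊑ d
⊑-comparable {e = e} (m , refl) (n , refl) c≤d with ≤-total n m
... | inj₁ n≤m = m ∸ n , trans (sym (ancestor-+ (m ∸ n) n e)) (cong (λ k → ancestor k e) (m∸n+n≡m n≤m))
... | inj₂ m≤n = 0 , ≤-antisym (⊑⇒≤ (n ∸ m ,
  trans (sym (ancestor-+ (n ∸ m) m e)) (cong (λ k → ancestor k e) (m∸n+n≡m m≤n)))) c≤d

⊏-⊑-trans : ∀ {c d e} → c ⊏ d → d ⊑ e → c ⊏ e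
⊏-⊑-trans (c<d , c⊑d) d⊑e = <-≤-trans c<d (⊑⇒≤ d⊑e) , ⊑-trans c⊑d d⊑e

⊑-⊏-trans : ∀ {c d e} → c ⊑ d → d ⊏ e → c ⊏ e
⊑-⊏-trans c⊑d (d<e , d⊑e) = ≤-<-trans (⊑⇒≤ c⊑d) d<e , ⊑-trans c⊑d d⊑e

⊏-child : ∀ {c d} → c ⊏ d → ∃[ x ] suc ⟨ x , c ⟩ ⊑ d
⊏-child {d = d} (c<d , n , eq) = go n eq c<d
  where
  go : ∀ n {c} → ancestor n d ≡ c → c < d → ∃[ x ] suc ⟨ x , c ⟩ ⊑ d
  go zero    refl c<d = contradiction c<d (<-irrefl refl)
  go (suc n) eq   c<d with ancestor n d in eqₙ
  ... | zero  = go n (trans eqₙ (trans (sym (n≤0⇒n≡0 (π₂-≤ 0))) eq)) c<d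
  ... | suc z = π₁ z , n , trans eqₙ (cong suc (trans (sym (⟨⟩-π z)) (cong ⟨ π₁ z ,_⟩ eq)))

initial-⊑-suc : ∀ f n → initial f n ⊑ initial f (suc n)
initial-⊑-suc f n = 1 , π₂-⟨⟩ (f n) (initial f n)

initial-mono : ∀ f {m n} → m ≤ n → initial f m ⊑ initial f n
initial-mono f m≤n = go (≤⇒≤′ m≤n)
  where
  go : ∀ {m n} → m ≤′ n → initial f m ⊑ initial f n
  go ≤′-refl       = ⊑-refl
  go (≤′-step m≤n) = ⊑-trans (go m≤n) (initial-⊑-suc f _)

initial-< : ∀ f n → initial f n < initial f (suc n)
initial-< f n = s≤s (m≤n+m (initial f n) (triangle (f n + initial f n)))

n≤initial : ∀ f n → n ≤ initial f n
n≤initial f zero    = z≤n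
n≤initial f (suc n) = ≤-trans (s≤s (n≤initial f n)) (initial-< f n)

initial-⊏ : ∀ f {m n} → m < n → initial f m ⊏ initial f n
initial-⊏ f {m} m<n = ⊏-⊑-trans (initial-< f m , initial-⊑-suc f m) (initial-mono f m<n)

⊑-initial : ∀ f n {c} → c ⊑ initial f n → ∃[ m ] c ≡ initial f m
⊑-initial f n (m , eq) = go m n eq
  where
  go : ∀ m n {c} → ancestor m (initial f n) ≡ c → ∃[ l ] c ≡ initial f l
  go zero    n eq = n , sym eq
  go (suc m) n eq with l , eq′ ← go m n refl with l
  ... | zero  = 0 , trans (sym eq) (trans (cong parent eq′) (n≤0⇒n≡0 (π₂-≤ 0)))
  ... | suc l = l , trans (sym eq) (trans (cong parent eq′) (π₂-⟨⟩ (f l) (initial f l)))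

push : ℕ → ℕ → ℕ
push zero    r = r
push (suc z) r = suc ⟨ π₁ z , r ⟩

-- Moves the last n entries of the sequence c, in their order, to the front of
-- the sequence coded (as by codeSeq) by r.
unwind : ℕ → ℕ → ℕ → ℕ
unwind r c zero    = r
unwind r c (suc n) = push (ancestor n c) (unwind r c n)

-- The code `c` itself bounds the length of its sequence; surplus steps meet the empty sequence, and
-- `push` at 0 changes nothing.
toCodeSeq : ℕ → ℕ
toCodeSeq c = unwind 0 c c

-- The definition peels off the step count from the far end; induction along `initial` needs the
-- last entry of the sequence to be moved first.
unwind-suc : ∀ n r z → unwind r (suc z) (suc n) ≡ unwind (suc ⟨ π₁ z , r ⟩) (π₂ z) n
unwind-suc zero    r z = refl
unwind-suc (suc n) r z = cong₂ push
  (trans (cong (λ k → ancestor k (suc z)) (+-comm 1 n)) (ancestor-+ n 1 (suc z)))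
  (unwind-suc n r z)

unwind-initial : ∀ f m n xs → m ≤ n →
                 unwind (codeSeq xs) (initial f m) n ≡ codeSeq (applyUpTo f m ++ xs)
unwind-initial f zero    zero    xs _ = refl
unwind-initial f zero    (suc n) xs _ =
  trans (cong (λ c → push c (unwind (codeSeq xs) 0 n)) (ancestor≡0 {n} z≤n)) (unwind-initial f zero n xs z≤n)
unwind-initial f (suc m) (suc n) xs (s≤s m≤n) = begin
  unwind (codeSeq xs) (suc z) (suc n)
    ≡⟨ unwind-suc n (codeSeq xs) z ⟩
  unwind (suc ⟨ π₁ z , codeSeq xs ⟩) (π₂ z) n
    ≡⟨ cong₂ (λ x c → unwind (suc ⟨ x , codeSeq xs ⟩) c n) (π₁-⟨⟩ (f m) _) (π₂-⟨⟩ (f m) _) ⟩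
  unwind (codeSeq (f m ∷ xs)) (initial f m) n
    ≡⟨ unwind-initial f m n (f m ∷ xs) m≤n ⟩
  codeSeq (applyUpTo f m ++ f m ∷ xs)
    ≡⟨ cong codeSeq (++-assoc (applyUpTo f m) (f m ∷ []) xs) ⟨
  codeSeq ((applyUpTo f m ++ f m ∷ []) ++ xs)
    ≡⟨ cong (λ ys → codeSeq (ys ++ xs)) (applyUpTo-∷ʳ f m) ⟩
  codeSeq (applyUpTo f (suc m) ++ xs) ∎
  where
  open ≡-Reasoning
  z : ℕ
  z = ⟨ f m , initial f m ⟩

toCodeSeq-initial : ∀ f n → toCodeSeq (initial f n) ≡ codeSeq (applyUpTo f n)
toCodeSeq-initial f n = trans (unwind-initial f n (initial f n) [] (n≤initial f n))
  (cong codeSeq (++-identityʳ (applyUpTo f n)))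

parent-computable : Computable parent
parent-computable = computable (lift₁ π₂-computable (lift₁ pred-computable (var (# 0)))) λ _ → refl

ancestor-computable : Computable₂ ancestor
ancestor-computable =
  computable₂ (recursion (var (# 0)) (var (# 1)) (lift₁ parent-computable (var (# 1)))) go
  where
  go : ∀ n c → recur n c (λ _ r → parent r) ≡ ancestor n c
  go zero    c = refl
  go (suc n) c = cong parent (go n c)

push-computable : Computable₂ push
push-computable = computable₂ (recursion (var (# 0)) (var (# 1))
  (lift₁ suc-computable (lift₂ ⟨⟩-computable (lift₁ π₁-computable (var (# 0))) (var (# 3)))))
  λ { zero _ → refl ; (suc _) _ → refl }

toCodeSeq-computable : Computable toCodeSeq
toCodeSeq-computable = computable (recursion (var (# 0)) (constᵗ 0)
  (lift₂ push-computable (lift₂ ancestor-computable (var (# 0)) (var (# 2))) (var (# 1))))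
  λ c → go c c
  where
  go : ∀ c n → recur n 0 (λ i r → push (ancestor i c) r) ≡ unwind 0 c n
  go c zero    = refl
  go c (suc n) = cong (push (ancestor n c)) (go c n)

_⊑ʳ_ : Total F → Total G → Recursive (λ xs → F xs ⊑ G xs)
f ⊑ʳ g = Recursive-⇔ (λ _ → mk⇔ (λ (n , _ , eq) → n , eq) ⊑-bounded)
  (∃≤ʳ g (lift₂ ancestor-computable (var (# 0)) (compose g (tailᵗ idᵗ)) ≡ʳ compose f (tailᵗ idᵗ)))

_⊏ʳ_ : Total F → Total G → Recursive (λ xs → F xs ⊏ G xs)
f ⊏ʳ g = lift₁ suc-computable f ≤ʳ g ×ʳ (f ⊑ʳ g)

-- Trees of Π¹₁ sets

-- The number d also bounds the computations, so that the tree is decidable;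
-- it still has f as a path only if c is undefined at every initial segment of
-- f, because d is unbounded along f.
record Tree (c : Rec 2) (p d : ℕ) : Set where
  constructor tree
  field unhit : ∀ {e} → e ≤ d → ∀ {s} → s ≤ d → e ⊑ d → run c s (p ∷ toCodeSeq e ∷ []) ≡ 0
open Tree

Tree-closed : ∀ {c p d d′} → d ⊑ d′ → Tree c p d′ → Tree c p d
Tree-closed d⊑d′ t = tree λ e≤d s≤d e⊑d →
  unhit t (≤-trans e≤d (⊑⇒≤ d⊑d′)) (≤-trans s≤d (⊑⇒≤ d⊑d′)) (⊑-trans e⊑d d⊑d′)

Treeʳ : ∀ c → Total F → Total G → Recursive (λ xs → Tree c (F xs) (G xs))
Treeʳ c f g = Recursive-⇔ (λ _ → mk⇔ tree unhit)
  (∀≤ʳ g (∀≤ʳ (compose g (tailᵗ idᵗ))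
    ((var (# 1) ⊑ʳ compose g (tailᵗ (tailᵗ idᵗ))) →ʳ
      (compose (runᵗ c) (var (# 0) ∷ᵗ compose f (tailᵗ (tailᵗ idᵗ)) ∷ᵗ
        lift₁ toCodeSeq-computable (var (# 1)) ∷ᵗ []ᵗ) ≡ʳ constᵗ 0))))

module _ {R : Rel ℕ 0ℓ} (ce : CE₂ R) (p : ℕ) (f : ℕ → ℕ) where
  open Σ ce renaming (proj₁ to c; proj₂ to R⇔)

  Tree-initial⇒ : (∀ n → Tree c p (initial f n)) → ∀ n → ¬ R p (codeSeq (applyUpTo f n))
  Tree-initial⇒ t n r =
    let y , c⇓ = to (R⇔ _ _) r
        s , eq = run-complete c _ c⇓
        -- Length `s + n` makes the code at least `s`, so the node there already sees the
        -- computation that halts with bound `s`.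
        n⊑ = initial-mono f (m≤n+m n s)
    in 0≢1+n (begin
      0
        ≡⟨ unhit (t (s + n)) (⊑⇒≤ n⊑) (≤-trans (m≤m+n s n) (n≤initial f (s + n))) n⊑ ⟨
      run c s (p ∷ toCodeSeq (initial f n) ∷ [])
        ≡⟨ cong (λ x → run c s (p ∷ x ∷ [])) (toCodeSeq-initial f n) ⟩
      run c s (p ∷ codeSeq (applyUpTo f n) ∷ [])
        ≡⟨ eq s ≤-refl ⟩
      suc y ∎)
    where open ≡-Reasoning

  Tree-initial⇐ : (∀ n → ¬ R p (codeSeq (applyUpTo f n))) → ∀ n → Tree c p (initial f n)
  Tree-initial⇐ ¬r n = tree λ {e} _ {s} _ e⊑ → none e s e⊑
    where
    none : ∀ e s → e ⊑ initial f n → run c s (p ∷ toCodeSeq e ∷ []) ≡ 0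
    none e s e⊑ with run c s (p ∷ toCodeSeq e ∷ []) in eq
    ... | zero  = refl
    ... | suc y with m , refl ← ⊑-initial f n e⊑ =
      contradiction (from (R⇔ _ _) (y , subst (λ x → c [ p ∷ x ∷ [] ]⇓ y) (toCodeSeq-initial f m)
        (run-sound c s _ eq))) (¬r m)

-- Metrics

above-cut : ∀ x {p q} → q ∉ cut x → p ∈ cut x → p ℚ.< q
above-cut x {p} {q} q∉ p∈ with ℚ.<-cmp p q
... | tri< p<q _ _  = p<q
... | tri≈ _ refl _ = contradiction p∈ q∉
... | tri> _ _ q<p  = contradiction (down x q<p p∈) q∉

0<difference : ∀ {p q} → p ℚ.< q → 0ℚ ℚ.< q ℚ.- p
0<difference {p} {q} p<q = subst (ℚ._< q ℚ.- p) (ℚ.+-inverseʳ p) (ℚ.+-monoˡ-< (ℚ.- p) p<q)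

cancel-difference : ∀ p q → p ℚ.+ (q ℚ.- p) ≡ q
cancel-difference p q = begin
  p ℚ.+ (q ℚ.- p)     ≡⟨ ℚ.+-comm p (q ℚ.- p) ⟩
  q ℚ.- p ℚ.+ p       ≡⟨ ℚ.+-assoc q (ℚ.- p) p ⟩
  q ℚ.+ (ℚ.- p ℚ.+ p) ≡⟨ cong (q ℚ.+_) (ℚ.+-inverseˡ p) ⟩
  q ℚ.+ 0ℚ            ≡⟨ ℚ.+-identityʳ q ⟩
  q ∎
  where open ≡-Reasoning

rational : ℚ → ℝ
rational r = record
  { cut     = ℚ._< r
  ; inhab   = r ℚ.- 1ℚ , subst (r ℚ.- 1ℚ ℚ.<_) (ℚ.+-identityʳ r) (ℚ.+-monoʳ-< r (ℚ.negative⁻¹ (ℚ.- 1ℚ)))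
  ; proper  = r , ℚ.<-irrefl refl
  ; down    = ℚ.<-trans
  ; rounded = λ p<r → let q , p<q , q<r = ℚ.<-dense p<r in q , p<q , q<r
  }

≤ᴿ-+ʳ : ∀ x y → 0ᴿ ≤ᴿ y → x ≤ᴿ x +ᴿ y
≤ᴿ-+ʳ x y 0≤y {p} p∈ with q , p<q , q∈ ← rounded x p∈ =
  q , p ℚ.- q , q∈ , 0≤y negative , sym (cancel-difference q p)
  where
  negative : p ℚ.- q ℚ.< 0ℚ
  negative = subst (p ℚ.- q ℚ.<_) (ℚ.+-inverseʳ q) (ℚ.+-monoˡ-< (ℚ.- q) p<q)

≤ᴿ-+ˡ : ∀ x y → 0ᴿ ≤ᴿ x → y ≤ᴿ x +ᴿ y
≤ᴿ-+ˡ x y 0≤x p∈ with a , b , a∈ , b∈ , eq ← ≤ᴿ-+ʳ y x 0≤x p∈ = b , a , b∈ , a∈ , trans eq (ℚ.+-comm a b)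

-- Read `p ∉ cut x` as x ≤ p: rational upper bounds add up along the triangle inequality.
sum∉ : ∀ x y z → z ≤ᴿ x +ᴿ y → ∀ {p q} → p ∉ cut x → q ∉ cut y → p ℚ.+ q ∉ cut z
sum∉ x y z z≤ p∉ q∉ p+q∈ with a , b , a∈ , b∈ , eq ← z≤ p+q∈ =
  ℚ.<-irrefl (sym eq) (ℚ.+-mono-< (above-cut x p∉ a∈) (above-cut y q∉ b∈))

≤ᴿ-isPartialOrder : IsPartialOrder _≈ᴿ_ _≤ᴿ_
≤ᴿ-isPartialOrder = record
  { isPreorder = record
    { isEquivalence = record { refl = ≐-refl ; sym = ≐-sym ; trans = ≐-trans }
    ; reflexive     = proj₁
    ; trans         = λ p q → q ∘ p
    }
  ; antisym = _,_
  }

-- The last clause says that the closure of `W` lies in `U`, adherence being tested on basic sets.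
Regular : NumberedSpace → Set₁
Regular X = ∀ U → Open U → ∀ x → x ∈ U → Σ (Pred Point 0ℓ) λ W → Open W × x ∈ W ×
  (∀ y → (∀ n → y ∈ basic n → ∃[ z ] (z ∈ basic n × z ∈ W)) → y ∈ U)
  where open NumberedSpace X

metrizable⇒regular : ∀ X → Metrizable X → Regular X
metrizable⇒regular X (d , isMetric , metrizes) U open-U x x∈U
  with ε , (q₀ , q₀∉ , q₀∈) , inside ← to (metrizes U) open-U x x∈U
  with q , q₀<q , q∈ ← rounded ε q₀∈
  -- If `y` is adherent to the ball of radius `r` about `x`, some `z` in that ball is within `q - r`
  -- of `y`. So the distance from `x` to `y` is below `q`, and hence below `ε`.
  with r , 0<r , r<q ← ℚ.<-dense (ℚ.≤-<-trans (ℚ.≮⇒≥ q₀∉) q₀<q) =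
    ball x r , ball-open x r , centre x 0<r , λ y adherent →
      let n , y∈n , n⊆ball = ball-open y (q ℚ.- r) y (centre y (0<difference r<q))
          z , z∈n , (s , s∉ , s<r) = adherent n y∈n
          (t , t∉ , t<) = n⊆ball z∈n
      in inside y (s ℚ.+ t ,
           sum∉ (d x z) (d z y) (d x y) (Metric.triangle x z y) s∉ (t∉ ∘ proj₁ (Metric.sym z y)) ,
           down ε (subst (s ℚ.+ t ℚ.<_) (cancel-difference r q) (ℚ.+-mono-< s<r t<)) q∈)
  where
  open NumberedSpace X using (Point; Open)
  module Metric = IsGeneralMetric isMetric
  ball : Point → ℚ → Pred Point 0ℓ
  ball x r y = ∃[ p ] (p ∉ cut (d x y) × p ℚ.< r)
  centre : ∀ x {r} → 0ℚ ℚ.< r → x ∈ ball x r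
  centre x 0<r = 0ℚ , ℚ.<-irrefl refl ∘ proj₁ (Metric.≈⇒0 (Setoid.refl (NumberedSpace.points X))) , 0<r
  ball-open : ∀ x r → Open (ball x r)
  ball-open x r = from (metrizes (ball x r)) λ y (p , p∉ , p<r) →
    rational (r ℚ.- p) , (0ℚ , ℚ.<-irrefl refl , 0<difference p<r) , λ z (s , s∉ , s<) →
      p ℚ.+ s , sum∉ (d x y) (d y z) (d x z) (Metric.triangle x y z) p∉ s∉ ,
      subst (p ℚ.+ s ℚ.<_) (cancel-difference p r) (ℚ.+-monoʳ-< p s<)

-- The 0-1 metric of a discrete space

module Discrete (em : ∀ {ℓ} → ExcludedMiddle ℓ) (X : NumberedSpace) where
  open NumberedSpace X
  private module S = Setoid points

  -- With the decision as an argument, each metric law becomes a case analysis comparing decisions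
  -- of related propositions.
  gap : ∀ {A : Set} → Dec A → ℝ
  gap (yes _) = 0ᴿ
  gap (no _)  = rational 1ℚ

  distance : Point → Point → ℝ
  distance x y = gap (em {P = x ≈ y})

  gap-mono : ∀ {A B : Set} (a : Dec A) (b : Dec B) → (B → A) → gap a ≤ᴿ gap b
  gap-mono (yes _) (yes _) _  = id
  gap-mono (yes _) (no _)  _  = λ p<0 → ℚ.<-trans p<0 (ℚ.positive⁻¹ 1ℚ)
  gap-mono (no ¬a) (yes b) ba = ⊥-elim (¬a (ba b))
  gap-mono (no _)  (no _)  _  = id

  0≤gap : ∀ {A : Set} (a : Dec A) → 0ᴿ ≤ᴿ gap a
  0≤gap a = gap-mono (yes a) a λ _ → a

  gap≡0 : ∀ {A : Set} (a : Dec A) → A → gap a ≤ᴿ 0ᴿ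
  gap≡0 a x = gap-mono a (yes x) id

  gap<1 : ∀ {A : Set} (a : Dec A) → gap a <ᴿ rational 1ℚ → A
  gap<1 (yes x) _             = x
  gap<1 (no _)  (_ , q∉ , q∈) = ⊥-elim (q∉ q∈)

  gap-triangle : ∀ {A B C : Set} (a : Dec A) (b : Dec B) (c : Dec C) → (A → B → C) →
                 gap c ≤ᴿ gap a +ᴿ gap b
  gap-triangle (no ¬a) b c _ =
    ≤ᴿ-+ʳ (gap (no ¬a)) (gap b) (0≤gap b) ∘ gap-mono c (no ¬a) λ x → contradiction x ¬a
  gap-triangle (yes a) b c f = ≤ᴿ-+ˡ 0ᴿ (gap b) id ∘ gap-mono c b (f a)

  discrete⇒metrizable : (∀ x → ∃[ n ] (x ∈ basic n × (∀ y → y ∈ basic n → x ≈ y))) → Metrizable X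
  discrete⇒metrizable isolated = distance , isGeneralMetric , λ U → mk⇔ refine coarsen
    where
    MetricOpen : Pred Point 0ℓ → Set₁
    MetricOpen U = ∀ x → x ∈ U → ∃[ ε ] (0ᴿ <ᴿ ε × (∀ y → distance x y <ᴿ ε → y ∈ U))
    positive : 0ᴿ <ᴿ rational 1ℚ
    positive = 0ℚ , ℚ.<-irrefl refl , ℚ.positive⁻¹ 1ℚ
    refine : ∀ {U} → Open U → MetricOpen U
    refine open-U x x∈U with n , x∈n , n⊆U ← open-U x x∈U =
      rational 1ℚ , positive , λ y d<1 → n⊆U (basic-resp n (gap<1 em d<1) x∈n)
    coarsen : ∀ {U} → MetricOpen U → Open U
    coarsen open-U x x∈U
      with n , x∈n , only ← isolated x
      with ε , (q , q∉ , q∈) , inside ← open-U x x∈U =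
        n , x∈n , λ {y} y∈n → inside y (q , q∉ ∘ gap≡0 em (only y y∈n) , q∈)
    isGeneralMetric : IsGeneralMetric _≈_ _≈ᴿ_ _≤ᴿ_ 0ᴿ _+ᴿ_ distance
    isGeneralMetric = record
      { isSemiMetric = record
        { isQuasiSemiMetric = record
          { isPreMetric = record
            { isProtoMetric = record
              { isPartialOrder  = ≤ᴿ-isPartialOrder
              ; ≈-isEquivalence = S.isEquivalence
              ; cong            = λ x≈x′ y≈y′ →
                  gap-mono em em (λ e → S.trans x≈x′ (S.trans e (S.sym y≈y′))) ,
                  gap-mono em em (λ e → S.trans (S.sym x≈x′) (S.trans e y≈y′))
              ; nonNegative     = 0≤gap em
              }
            ; ≈⇒0 = λ x≈y → gap≡0 em x≈y , 0≤gap em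
            }
          ; 0⇒≈ = λ (d≤0 , _) → gap<1 em (0ℚ , ℚ.<-irrefl refl ∘ d≤0 , ℚ.positive⁻¹ 1ℚ)
          }
        ; sym = λ x y → gap-mono em em S.sym , gap-mono em em S.sym
        }
      ; triangle = λ x y z → gap-triangle em em em S.trans
      }

-- The spaces

kind label pos : ℕ → ℕ
kind e  = π₁ e
label e = π₁ (π₂ e)
pos e   = π₂ (π₂ e)

-- Every nonzero kind counts as a star, so each number is an element of the relation and none needs
-- separate treatment.
Node Star : Pred ℕ 0ℓ
Node e = kind e ≡ 0
Star e = ¬ Node e

opaque
  element : ℕ → ℕ → ℕ → ℕ
  element s a c = ⟨ s , ⟨ a , c ⟩ ⟩

  kind-element : ∀ s a c → kind (element s a c) ≡ s
  kind-element s a c = π₁-⟨⟩ s ⟨ a , c ⟩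

  label-element : ∀ s a c → label (element s a c) ≡ a
  label-element s a c = trans (cong π₁ (π₂-⟨⟩ s ⟨ a , c ⟩)) (π₁-⟨⟩ a c)

  star-element : ∀ b c → Star (element 1 b c)
  star-element b c n≡ = 1+n≢0 (trans (sym (kind-element 1 b c)) n≡)

  pos-element : ∀ s a c → pos (element s a c) ≡ c
  pos-element s a c = trans (cong π₂ (π₂-⟨⟩ s ⟨ a , c ⟩)) (π₂-⟨⟩ a c)

infix 4 _⊴_

-- Going from 0 to 1 is the only change of label along a step; it puts the nodes of label 0 on a
-- path into the ideal of label 1.
_⊴_ : Rel ℕ 0ℓ
a ⊴ b = a ≡ b ⊎ (a ≡ 0 × b ≡ 1)

⊴-trans : Transitive _⊴_
⊴-trans (inj₁ refl)          b⊴c         = b⊴c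
⊴-trans (inj₂ (refl , refl)) (inj₁ refl) = inj₂ (refl , refl)

⊴⇒≡ : ∀ {a b} → 2 ≤ a → a ⊴ b → a ≡ b
⊴⇒≡ _       (inj₁ eq)       = eq
⊴⇒≡ (s≤s _) (inj₂ (() , _))

-- Here `a` and `c` are label and position of the node and `b` is the label of the star. A node of
-- label 4 loses the stars of label `b` once its position exceeds `b`, but keeps those of all larger
-- labels.
Attached : ℕ → ℕ → ℕ → Set
Attached a c b = a ≤ 3 ⊎ (a ≡ 4 × c ≤ b) ⊎ a ≡ 5 + b

-- An infinite path through T becomes a point for each label a, having the
-- nodes of label a along the path as a neighbourhood base; stars become
-- isolated points.  Labels 0 and 1 give two points, the second in every
-- neighbourhood of the first; labels 2 and 3 give two points that cannot be
-- separated; label 4 gives a limit of the stars attached to the labels 5 + b,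
-- none of whose neighbourhoods has a closure avoiding the points 5 + b.
data Step (T : ℕ → ℕ → Set) (e e′ : ℕ) : Set where
  extend : Node e → Node e′ → label e ⊴ label e′ → pos e ⊏ pos e′ → T (label e′) (pos e′) → Step T e e′
  attach : Node e → Star e′ → pos e ⊑ pos e′ → Attached (label e) (pos e) (label e′) → Step T e e′
  loop   : Star e → e ≡ e′ → Step T e e′

module _ {T : ℕ → ℕ → Set} where

  Step-trans : Transitive (Step T)
  Step-trans (extend n _ a⊴ p⊏ _) (extend _ n″ b⊴ q⊏ t) =
    extend n n″ (⊴-trans a⊴ b⊴) (⊏-⊑-trans p⊏ (proj₂ q⊏)) t
  Step-trans (extend n _ a⊴ p⊏ _) (attach _ s q⊑ att) =
    attach n s (⊑-trans (proj₂ p⊏) q⊑) (weaken a⊴ (⊑⇒≤ (proj₂ p⊏)) att)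
    where
    -- Attachment has to pass down to earlier nodes. The bound for label 4 does so because positions
    -- decrease downwards, and label 0 below label 1 is attached to every star.
    weaken : ∀ {a b c d x} → a ⊴ b → c ≤ d → Attached b d x → Attached a c x
    weaken (inj₂ (refl , refl)) _ _                  = inj₁ z≤n
    weaken (inj₁ refl) _ (inj₁ a≤3)                  = inj₁ a≤3
    weaken (inj₁ refl) c≤d (inj₂ (inj₁ (a≡4 , d≤x))) = inj₂ (inj₁ (a≡4 , ≤-trans c≤d d≤x))
    weaken (inj₁ refl) _ (inj₂ (inj₂ a≡))            = inj₂ (inj₂ a≡)
  Step-trans (extend _ n _ _ _) (loop s _) = contradiction n s
  Step-trans (attach _ s _ _) (extend n _ _ _ _) = contradiction n s
  Step-trans (attach _ s _ _) (attach n _ _ _) = contradiction n s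
  Step-trans (attach n s p⊑ att) (loop _ refl) = attach n s p⊑ att
  Step-trans (loop _ refl) st = st

Stepʳ : {T : ℕ → ℕ → ℕ → Set} →
        Recursive {3} (λ xs → T (lookup xs (# 0)) (label (lookup xs (# 2))) (pos (lookup xs (# 2)))) →
        Recursive {3} (λ xs → Step (T (lookup xs (# 0))) (lookup xs (# 1)) (lookup xs (# 2)))
Stepʳ {T} t = Recursive-⇔ (λ { (p ∷ e ∷ e′ ∷ []) → mk⇔ fold unfold })
  ((node e ×ʳ node e′ ×ʳ (lab e ≡ʳ lab e′ ⊎ʳ lab e ≡ʳ constᵗ 0 ×ʳ lab e′ ≡ʳ constᵗ 1) ×ʳ
     (place e ⊏ʳ place e′) ×ʳ t)
   ⊎ʳ (node e ×ʳ star e′ ×ʳ (place e ⊑ʳ place e′) ×ʳ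
     (lab e ≤ʳ constᵗ 3 ⊎ʳ (lab e ≡ʳ constᵗ 4 ×ʳ place e ≤ʳ lab e′) ⊎ʳ
       lab e ≡ʳ lift₂ +-computable (constᵗ 5) (lab e′)))
   ⊎ʳ (star e ×ʳ e ≡ʳ e′))
  where
  e e′ : Total _
  e  = var {3} (# 1)
  e′ = var {3} (# 2)
  lab place : ∀ {F : Vec ℕ 3 → ℕ} → Total F → Total _
  lab f   = lift₁ π₁-computable (lift₁ π₂-computable f)
  place f = lift₁ π₂-computable (lift₁ π₂-computable f)
  node star : ∀ {F : Vec ℕ 3 → ℕ} → Total F → Recursive _
  node f = lift₁ π₁-computable f ≡ʳ constᵗ 0
  star f = Recursive-⇔ (λ _ → mk⇔ n>0⇒n≢0 n≢0⇒n>0) (constᵗ 1 ≤ʳ lift₁ π₁-computable f)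
  fold : ∀ {T e e′} →
    (Node e × Node e′ × label e ⊴ label e′ × pos e ⊏ pos e′ × T (label e′) (pos e′))
    ⊎ (Node e × Star e′ × pos e ⊑ pos e′ × Attached (label e) (pos e) (label e′))
    ⊎ (Star e × e ≡ e′) → Step T e e′
  fold (inj₁ (n , n′ , a , p , t))      = extend n n′ a p t
  fold (inj₂ (inj₁ (n , s , p , att))) = attach n s p att
  fold (inj₂ (inj₂ (s , eq)))          = loop s eq
  unfold : ∀ {T e e′} → Step T e e′ →
    (Node e × Node e′ × label e ⊴ label e′ × pos e ⊏ pos e′ × T (label e′) (pos e′))
    ⊎ (Node e × Star e′ × pos e ⊑ pos e′ × Attached (label e) (pos e) (label e′))
    ⊎ (Star e × e ≡ e′)
  unfold (extend n n′ a p t)  = inj₁ (n , n′ , a , p , t)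
  unfold (attach n s p att) = inj₂ (inj₁ (n , s , p , att))
  unfold (loop s eq)        = inj₂ (inj₂ (s , eq))

module Space
  (em : ∀ {ℓ} → ExcludedMiddle ℓ)
  {T : ℕ → ℕ → Set}
  (T-closed : ∀ {a c d} → c ⊑ d → T a d → T a c)
  (T-⊴ : ∀ {a b d} → a ⊴ b → T b d → T a d)
  {_≺_ : Rel ℕ 0ℓ}
  (≺⇔ : ∀ i j → i ≺ j ⇔ Step T i j)
  where

  private
    X : NumberedSpace
    X = 𝓘 _≺_

  open NumberedSpace X using (Open; Point; _≈_)

  step : ∀ {i j} → i ≺ j → Step T i j
  step = to (≺⇔ _ _)

  unstep : ∀ {i j} → Step T i j → i ≺ j
  unstep = from (≺⇔ _ _)

  ≺-trans : Transitive _≺_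
  ≺-trans p q = unstep (Step-trans (step p) (step q))

  stable : {P : Set} → ¬ ¬ P → P
  stable = decidable-stable em

  Path : ℕ → (ℕ → ℕ) → Set
  Path a f = ∀ n → T a (initial f n)

  StarFree : Pred ℕ 0ℓ → Set
  StarFree I = I ⊆ Node

  star-top : ∀ {e l} → Star e → e ≺ l → e ≡ l
  star-top s e≺l with step e≺l
  ... | extend n _ _ _ _ = contradiction n s
  ... | attach n _ _ _   = contradiction n s
  ... | loop _ eq        = eq

  star≺star : ∀ {e} → Star e → e ≺ e
  star≺star s = unstep (loop s refl)

  pos-⊑ : ∀ {e l} → e ≺ l → pos e ⊑ pos l
  pos-⊑ e≺l with step e≺l
  ... | extend _ _ _ p _ = proj₂ p
  ... | attach _ _ p _   = p
  ... | loop _ refl      = ⊑-refl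

  starIdeal : ∀ {e} → Star e → IsIdeal _≺_ (_≺ e)
  starIdeal s = record
    { nonempty = _ , star≺star s
    ; lower    = ≺-trans
    ; directed = λ i≺ j≺ → _ , star≺star s , i≺ , j≺
    }

  starPoint : ∀ {e} → Star e → Point
  starPoint s = _ , starIdeal s

  pathIdeal : ∀ {a f} → Path a f →
              IsIdeal _≺_ (λ e → Node e × label e ⊴ a × ∃[ n ] pos e ≡ initial f n)
  pathIdeal {a} {f} path = record
    { nonempty = element 0 a 0 , kind-element 0 a 0 , inj₁ (label-element 0 a 0) , 0 , pos-element 0 a 0
    ; lower    = lower
    ; directed = directed
    }
    where
    I : Pred ℕ 0ℓ
    I e = Node e × label e ⊴ a × ∃[ n ] pos e ≡ initial f n
    lower : ∀ {i j} → i ≺ j → I j → I i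
    lower i≺j (nⱼ , j⊴ , n , eqⱼ) with step i≺j
    ... | extend nᵢ _ i⊴ p _ = nᵢ , ⊴-trans i⊴ j⊴ , ⊑-initial f n (subst (_ ⊑_) eqⱼ (proj₂ p))
    ... | attach _ s _ _     = contradiction nⱼ s
    ... | loop s refl        = contradiction nⱼ s
    below : ∀ {i m} n → m < n → Node i → label i ⊴ a → pos i ≡ initial f m → i ≺ element 0 a (initial f n)
    below n m<n nᵢ i⊴ eq = unstep (extend nᵢ (kind-element 0 a _)
      (subst (_ ⊴_) (sym (label-element 0 a _)) i⊴)
      (subst₂ _⊏_ (sym eq) (sym (pos-element 0 a _)) (initial-⊏ f m<n))
      (subst₂ T (sym (label-element 0 a _)) (sym (pos-element 0 a _)) (path n)))
    directed : ∀ {i j} → I i → I j → ∃[ l ] (I l × i ≺ l × j ≺ l)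
    directed (nᵢ , i⊴ , m , eqᵢ) (nⱼ , j⊴ , n , eqⱼ) =
      element 0 a (initial f (suc (m + n))) ,
      (kind-element 0 a _ , inj₁ (label-element 0 a _) , _ , pos-element 0 a _) ,
      below (suc (m + n)) (s≤s (m≤m+n m n)) nᵢ i⊴ eqᵢ , below (suc (m + n)) (s≤s (m≤n+m n m)) nⱼ j⊴ eqⱼ

  pathPoint : ∀ {a f} → Path a f → Point
  pathPoint path = _ , pathIdeal path

  overt : Overt X
  overt = zero , λ n → mk⇔ (λ _ → 0 , ⇓zero) (λ _ → inhabited n)
    where
    attached : ∀ a c → ∃[ b ] Attached a c b
    attached 0 c = 0 , inj₁ z≤n
    attached 1 c = 0 , inj₁ (s≤s z≤n)
    attached 2 c = 0 , inj₁ (s≤s (s≤s z≤n))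
    attached 3 c = 0 , inj₁ ≤-refl
    attached 4 c = c , inj₂ (inj₁ (refl , ≤-refl))
    attached (suc (suc (suc (suc (suc b))))) c = b , inj₂ (inj₂ refl)
    inhabited : ∀ n → Satisfiable (NumberedSpace.basic X n)
    inhabited n with kind n ≟ 0
    ... | no s  = starPoint s , star≺star s
    ... | yes nₙ with b , att ← attached (label n) (pos n) =
      starPoint (star-element b (pos n)) , unstep (attach nₙ (star-element b _)
        (subst (_ ⊑_) (sym (pos-element 1 b _)) ⊑-refl)
        (subst (Attached _ _) (sym (label-element 1 b _)) att))

  module _ {I : Pred ℕ 0ℓ} (isIdeal : IsIdeal _≺_ I) where
    open IsIdeal isIdeal

    -- Only the star itself lies above it, so directedness puts the whole ideal below it.
    star-principal : ∀ {e} → Star e → e ∈ I → ∀ {i} → i ∈ I → i ≺ e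
    star-principal s e∈ i∈ with l , _ , e≺l , i≺l ← directed e∈ i∈ with refl ← star-top s e≺l = i≺l

    module _ (free : StarFree I) where

      next : ∀ {i} → i ∈ I →
        ∃[ j ] (j ∈ I × label i ⊴ label j × pos i ⊏ pos j × T (label j) (pos j))
      next i∈ with j , j∈ , i≺j , _ ← directed i∈ i∈ with step i≺j
      ... | extend _ _ a p t = j , j∈ , a , p , t
      ... | attach _ s _ _   = contradiction (free j∈) s
      ... | loop s refl      = contradiction (free j∈) s

      deep : ∀ {i} → i ∈ I → ∀ n → ∃[ j ] (j ∈ I × label i ⊴ label j × n ≤ pos j)
      deep i∈ zero    = _ , i∈ , inj₁ refl , z≤n
      deep i∈ (suc n) with j , j∈ , a , n≤ ← deep i∈ n with l , l∈ , b , p , _ ← next j∈ =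
        l , l∈ , ⊴-trans a b , ≤-trans (s≤s n≤) (proj₁ p)

      -- `next` yields ever longer positions on the tree. The path is fixed one entry at a time,
      -- `Below c` carrying a member of `I` whose position extends `c`. The label may rise from 0 to
      -- 1 on the way; `T-⊴` brings the tree back to the label of `i`.
      ideal-path : ∀ {i} → i ∈ I → ∃[ f ] Path (label i) f
      ideal-path {i} i∈ = f , λ n →
        let j , _ , a , t , p = proj₂ (branch n) in
        T-closed (subst (_⊑ pos j) (sym (initial-f n)) p) (T-⊴ a t)
        where
        Below : ℕ → Set
        Below c = ∃[ j ] (j ∈ I × label i ⊴ label j × T (label j) (pos j) × c ⊑ pos j)
        grow : ∀ {c} → Below c → ∃[ x ] Below (suc ⟨ x , c ⟩)
        grow (j , j∈ , a , _ , p) with l , l∈ , b , q , t ← next j∈ with x , r ← ⊏-child (⊑-⊏-trans p q) =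
          x , l , l∈ , ⊴-trans a b , t , r
        branch : ∀ n → ∃[ c ] Below c
        branch zero    = let j , j∈ , a , _ , t = next i∈ in 0 , j , j∈ , a , t , 0⊑ (pos j)
        branch (suc n) = _ , proj₂ (grow (proj₂ (branch n)))
        f : ℕ → ℕ
        f n = proj₁ (grow (proj₂ (branch n)))
        initial-f : ∀ n → initial f n ≡ proj₁ (branch n)
        initial-f zero    = refl
        initial-f (suc n) = cong (λ c → suc ⟨ f n , c ⟩) (initial-f n)

      prefix-closed : ∀ {i j} → j ∈ I → Node i → label i ≡ label j → pos i ⊏ pos j → i ∈ I
      prefix-closed j∈ nᵢ eq p with l , l∈ , a , q , t ← next j∈ =
        lower (unstep (extend nᵢ (free l∈) (subst (_⊴ _) (sym eq) a) (⊏-⊑-trans p (proj₂ q)) t)) l∈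

      label-constant : (∀ {e} → e ∈ I → 2 ≤ label e) → ∀ {i j} → i ∈ I → j ∈ I → label i ≡ label j
      label-constant large i∈ j∈ with l , l∈ , i≺l , j≺l ← directed i∈ j∈ with step i≺l | step j≺l
      ... | extend _ _ a _ _ | extend _ _ b _ _ = trans (⊴⇒≡ (large i∈) a) (sym (⊴⇒≡ (large j∈) b))
      ... | attach _ s _ _   | _                = contradiction (free l∈) s
      ... | loop s refl      | _                = contradiction (free l∈) s
      ... | _ | attach _ s _ _                  = contradiction (free l∈) s
      ... | _ | loop s refl                     = contradiction (free l∈) s

  star-unique : ∀ {e} → Star e → ∀ (x y : Point) → e ∈ proj₁ x → e ∈ proj₁ y → x ≈ y
  star-unique s (I , i) (J , j) e∈I e∈J =
    (λ k∈ → IsIdeal.lower j (star-principal i s e∈I k∈) e∈J) ,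
    (λ k∈ → IsIdeal.lower i (star-principal j s e∈J k∈) e∈I)

  data Shape (I : Pred ℕ 0ℓ) : Set where
    starred  : ∀ {e} → Star e → e ∈ I → Shape I
    starfree : StarFree I → Shape I

  shape : ∀ I → Shape I
  shape I with em {P = ∃[ e ] (Star e × e ∈ I)}
  ... | yes (e , s , e∈) = starred s e∈
  ... | no none          = starfree λ e∈ → stable λ s → none (_ , s , e∈)

  large-labels : ∀ {b} → (∀ a f → a < b → ¬ Path a f) →
                 ∀ {I} → IsIdeal _≺_ I → StarFree I → ∀ {e} → e ∈ I → b ≤ label e
  large-labels no-path i free e∈ with f , path ← ideal-path i free e∈ =
    ≮⇒≥ λ e<b → no-path _ f e<b path

  -- Separation when small labels have no path

  basic-open : ∀ n → Open (NumberedSpace.basic X n)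
  basic-open n x n∈ = n , n∈ , id

  -- If no basic set separates `x` from `y`, then `I ⊆ J`; so the point is that no ideal lies
  -- properly inside another when star-free ideals have labels at least 2.
  T₁-space : (∀ a f → a < 2 → ¬ Path a f) → T₁ X
  T₁-space no-path x@(I , i) y@(J , j) x≉y with em {P = ∃[ n ] (n ∈ I × n ∉ J)}
  ... | yes (n , n∈I , n∉J) = _ , basic-open n , n∈I , n∉J
  ... | no none             = ⊥-elim (x≉y (I⊆J , J⊆I))
    where
    large : ∀ {I} → IsIdeal _≺_ I → StarFree I → ∀ {e} → e ∈ I → 2 ≤ label e
    large = large-labels no-path
    I⊆J : I ⊆ J
    I⊆J n∈I = stable λ n∉J → none (_ , n∈I , n∉J)
    J⊆I : J ⊆ I
    J⊆I {n} n∈J with shape I | shape J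
    ... | starred s e∈ | _ = proj₂ (star-unique s x y e∈ (I⊆J e∈)) n∈J
    -- A star in `J` would bound the positions in `I`, which are unbounded.
    ... | starfree free | starred {e} s e∈
      with k , k∈ , _ , e<k ← deep i free (proj₂ (IsIdeal.nonempty i)) (suc (pos e)) =
        contradiction (⊑⇒≤ (pos-⊑ (star-principal j s e∈ (I⊆J k∈)))) (<⇒≱ e<k)
    -- A member `k` of `I` longer than `n` has an upper bound in common with `n` in `J`, so `n` is a
    -- proper prefix of `k` with the same label.
    ... | starfree free | starfree free′
      with k , k∈ , _ , n<k ← deep i free (proj₂ (IsIdeal.nonempty i)) (suc (pos n))
      with l , _ , n≺l , k≺l ← IsIdeal.directed j n∈J (I⊆J k∈) =
        prefix-closed i free k∈ (free′ n∈J) (label-constant j free′ (large j free′) n∈J (I⊆J k∈))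
          (n<k , ⊑-comparable (pos-⊑ n≺l) (pos-⊑ k≺l) (<⇒≤ n<k))

  -- Without a common upper bound of `i` and `j`, no directed set contains both, so their basic sets
  -- are disjoint.
  Apart : Point → Point → Set
  Apart x y = ∃[ i ] ∃[ j ] (i ∈ proj₁ x × j ∈ proj₁ y × (∀ {l} → i ≺ l → ¬ j ≺ l))

  Apart-sym : ∀ {x y} → Apart x y → Apart y x
  Apart-sym (i , j , i∈ , j∈ , disj) = j , i , j∈ , i∈ , λ j≺l i≺l → disj i≺l j≺l

  -- The only labels from 4 on that share stars are 4 and `5 + l`, at the stars of label `l`, and
  -- only while the position of label 4 is at most `l`. A position of at least `a + b`, which is
  -- `9 + l`, is too large.
  labels-apart : ∀ {a b c d l} → 4 ≤ a → 4 ≤ b → a ≢ b → a + b ≤ c → a + b ≤ d →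
                 Attached a c l → ¬ Attached b d l
  labels-apart 4≤a _ _ _ _ (inj₁ a≤3) _ = <⇒≱ 4≤a a≤3
  labels-apart _ 4≤b _ _ _ _ (inj₁ b≤3) = <⇒≱ 4≤b b≤3
  labels-apart _ _ a≢b _ _ (inj₂ (inj₁ (refl , _))) (inj₂ (inj₁ (refl , _))) = a≢b refl
  labels-apart _ _ _ a+b≤c _ (inj₂ (inj₁ (refl , c≤l))) (inj₂ (inj₂ refl)) =
    <⇒≱ (s≤s (m≤n+m _ 8)) (≤-trans a+b≤c c≤l)
  labels-apart _ _ _ _ a+b≤d (inj₂ (inj₂ refl)) (inj₂ (inj₁ (refl , d≤l))) =
    <⇒≱ (s≤s (≤-trans (m≤m+n _ 4) (m≤n+m _ 4))) (≤-trans a+b≤d d≤l)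
  labels-apart _ _ a≢b _ _ (inj₂ (inj₂ refl)) (inj₂ (inj₂ refl)) = a≢b refl

  star-star-apart : ∀ x y {i j} → Star i → Star j → i ∈ proj₁ x → j ∈ proj₁ y → ¬ x ≈ y → Apart x y
  star-star-apart x y {i} {j} sᵢ sⱼ i∈ j∈ x≉y = i , j , i∈ , j∈ , disjoint
    where
    disjoint : ∀ {l} → i ≺ l → ¬ j ≺ l
    disjoint i≺l j≺l with refl ← star-top sᵢ i≺l with refl ← star-top sⱼ j≺l =
      x≉y (star-unique sᵢ x y i∈ j∈)

  star-free-apart : ∀ x y {e} → Star e → e ∈ proj₁ x → StarFree (proj₁ y) → Apart x y
  star-free-apart x (J , j) {e} s e∈ free
    with k , k∈ , _ , e<k ← deep j free (proj₂ (IsIdeal.nonempty j)) (suc (pos e)) =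
      e , k , e∈ , k∈ , disjoint
    where
    disjoint : ∀ {l} → e ≺ l → ¬ k ≺ l
    disjoint e≺l k≺l with refl ← star-top s e≺l = <⇒≱ e<k (⊑⇒≤ (pos-⊑ k≺l))

  module _ (x y : Point) (freeˣ : StarFree (proj₁ x)) (freeʸ : StarFree (proj₁ y))
    {a b} (labelˣ : ∀ {e} → e ∈ proj₁ x → label e ≡ a) (labelʸ : ∀ {e} → e ∈ proj₁ y → label e ≡ b)
    where

    -- A common upper bound of `i` and a longer `k` in `y` would make `i` a prefix of `k` with the
    -- same label, and so put `i` into `y`.
    difference-apart : a ≡ b → ∀ {i} → i ∈ proj₁ x → i ∉ proj₁ y → Apart x y
    difference-apart a≡b {i} i∈ i∉
      with k , k∈ , _ , i<k ← deep (proj₂ y) freeʸ (proj₂ (IsIdeal.nonempty (proj₂ y))) (suc (pos i)) =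
        i , k , i∈ , k∈ , λ i≺l k≺l → i∉ (prefix-closed (proj₂ y) freeʸ k∈ (freeˣ i∈)
          (trans (labelˣ i∈) (trans a≡b (sym (labelʸ k∈))))
          (i<k , ⊑-comparable (pos-⊑ i≺l) (pos-⊑ k≺l) (<⇒≤ i<k)))

    distinct-labels-apart : 4 ≤ a → 4 ≤ b → a ≢ b → Apart x y
    distinct-labels-apart 4≤a 4≤b a≢b
      with i , i∈ , _ , a+b≤i ← deep (proj₂ x) freeˣ (proj₂ (IsIdeal.nonempty (proj₂ x))) (a + b)
         | j , j∈ , _ , a+b≤j ← deep (proj₂ y) freeʸ (proj₂ (IsIdeal.nonempty (proj₂ y))) (a + b) =
        i , j , i∈ , j∈ , disjoint
      where
      large : ∀ {c e} → 4 ≤ c → label e ≡ c → 2 ≤ label e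
      large 4≤c eq = subst (2 ≤_) (sym eq) (≤-trans (s≤s (s≤s z≤n)) 4≤c)
      disjoint : ∀ {l} → i ≺ l → ¬ j ≺ l
      disjoint i≺l j≺l with step i≺l | step j≺l
      ... | extend _ _ p _ _ | extend _ _ q _ _ = a≢b (trans (sym (labelˣ i∈))
        (trans (⊴⇒≡ (large 4≤a (labelˣ i∈)) p) (trans (sym (⊴⇒≡ (large 4≤b (labelʸ j∈)) q)) (labelʸ j∈))))
      ... | attach _ _ _ p | attach _ _ _ q = labels-apart 4≤a 4≤b a≢b a+b≤i a+b≤j
        (subst (λ c → Attached c _ _) (labelˣ i∈) p) (subst (λ c → Attached c _ _) (labelʸ j∈) q)
      ... | extend _ n _ _ _ | attach _ s _ _   = s n
      ... | attach _ s _ _   | extend _ n _ _ _ = s n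
      ... | loop s _         | _                = s (freeˣ i∈)
      ... | _                | loop s _         = s (freeʸ j∈)

  separated : (∀ {I} → IsIdeal _≺_ I → StarFree I → ∀ {e} → e ∈ I → 4 ≤ label e) →
              ∀ x y → ¬ x ≈ y → Apart x y
  separated large x@(I , isI) y@(J , isJ) x≉y with shape I | shape J
  ... | starred sᵢ i∈  | starred sⱼ j∈  = star-star-apart x y sᵢ sⱼ i∈ j∈ x≉y
  ... | starred s e∈   | starfree free  = star-free-apart x y s e∈ free
  ... | starfree free  | starred s e∈   = Apart-sym {y} {x} (star-free-apart y x s e∈ free)
  ... | starfree freeᵢ | starfree freeⱼ
    with i , i∈ ← IsIdeal.nonempty isI | j , j∈ ← IsIdeal.nonempty isJ = by-label (label i ≟ label j)
    where
    constant : ∀ {I} (isI : IsIdeal _≺_ I) → StarFree I → ∀ {i e} → i ∈ I → e ∈ I → label e ≡ label i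
    constant isI free i∈ e∈ = label-constant isI free
      (λ e∈ → ≤-trans (s≤s (s≤s z≤n)) (large isI free e∈)) e∈ i∈
    by-label : Dec (label i ≡ label j) → Apart x y
    by-label (no i≢j) = distinct-labels-apart x y freeᵢ freeⱼ (constant isI freeᵢ i∈) (constant isJ freeⱼ j∈)
      (large isI freeᵢ i∈) (large isJ freeⱼ j∈) i≢j
    by-label (yes i≡j) with em {P = ∃[ n ] (n ∈ I × n ∉ J)} | em {P = ∃[ n ] (n ∈ J × n ∉ I)}
    ... | yes (n , n∈ , n∉) | _ =
      difference-apart x y freeᵢ freeⱼ (constant isI freeᵢ i∈) (constant isJ freeⱼ j∈) i≡j n∈ n∉
    ... | no _ | yes (n , n∈ , n∉) = Apart-sym {y} {x}
      (difference-apart y x freeⱼ freeᵢ (constant isJ freeⱼ j∈) (constant isI freeᵢ i∈) (sym i≡j) n∈ n∉)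
    ... | no I⊆J | no J⊆I = ⊥-elim
      (x≉y ((λ n∈ → stable λ n∉ → I⊆J (_ , n∈ , n∉)) , (λ n∈ → stable λ n∉ → J⊆I (_ , n∈ , n∉))))

  Hausdorff-space : (∀ a f → a < 4 → ¬ Path a f) → Hausdorff X
  Hausdorff-space no-path x y x≉y
    with i , j , i∈ , j∈ , disjoint ← separated (large-labels no-path) x y x≉y =
      _ , _ , basic-open i , basic-open j , i∈ , j∈ ,
      λ (K , isK) (i∈K , j∈K) → let l , _ , i≺l , j≺l = IsIdeal.directed isK i∈K j∈K in disjoint i≺l j≺l

  isolated-points : (∀ a f → ¬ Path a f) → ∀ x → ∃[ n ] (n ∈ proj₁ x × (∀ y → n ∈ proj₁ y → x ≈ y))
  isolated-points no-path x@(I , isI) with shape I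
  ... | starred s e∈  = _ , e∈ , λ y e∈y → star-unique s x y e∈ e∈y
  ... | starfree free with f , path ← ideal-path isI free (proj₂ (IsIdeal.nonempty isI)) =
    contradiction path (no-path _ f)

  -- Failure of separation along a path

  root∈ : ∀ {a f} (path : Path a f) → element 0 a 0 ∈ proj₁ (pathPoint path)
  root∈ path = proj₂ (IsIdeal.nonempty (pathIdeal path))

  root∈⇒⊴ : ∀ {a b f} (path : Path b f) → element 0 a 0 ∈ proj₁ (pathPoint path) → a ⊴ b
  root∈⇒⊴ _ (_ , a⊴b , _) = subst (_⊴ _) (label-element 0 _ 0) a⊴b

  path≺star : ∀ {i f m n b} → m ≤ n → Node i → pos i ≡ initial f m →
              Attached (label i) (initial f m) b → i ≺ element 1 b (initial f n)
  path≺star {f = f} m≤n nᵢ eq att = unstep (attach nᵢ (star-element _ _)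
    (subst₂ _⊑_ (sym eq) (sym (pos-element 1 _ _)) (initial-mono f m≤n))
    (subst₂ (Attached _) (sym eq) (sym (label-element 1 _ _)) att))

  not-T₁ : ∀ {f} → Path 0 f → Path 1 f → ¬ T₁ X
  not-T₁ {f} path₀ path₁ t₁
    with U , open-U , x∈U , y∉U ← t₁ (pathPoint path₀) (pathPoint path₁)
           (λ (_ , ⊇) → case root∈⇒⊴ path₀ (⊇ (root∈ path₁)) of λ { (inj₁ ()) ; (inj₂ ()) })
    with n , (nₙ , a , m , eq) , n⊆U ← open-U (pathPoint path₀) x∈U =
      y∉U (n⊆U (nₙ , ⊴-trans a (inj₂ (refl , refl)) , m , eq))

  not-Hausdorff : ∀ {f} → Path 2 f → Path 3 f → ¬ Hausdorff X
  not-Hausdorff {f} path₂ path₃ t₂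
    with U , U′ , open-U , open-U′ , x∈U , y∈U′ , disjoint ← t₂ (pathPoint path₂) (pathPoint path₃)
           (λ (⊆ , _) → case root∈⇒⊴ path₃ (⊆ (root∈ path₂)) of λ { (inj₁ ()) ; (inj₂ ()) })
    with i , (nᵢ , a , m , eqᵢ) , i⊆U ← open-U (pathPoint path₂) x∈U
    with j , (nⱼ , b , n , eqⱼ) , j⊆U′ ← open-U′ (pathPoint path₃) y∈U′ =
      -- Labels up to 3 are attached to every star, so a star placed beyond both positions lies in
      -- both neighbourhoods; its label 0 is arbitrary.
      disjoint (starPoint (star-element 0 (initial f (m + n))))
        ( i⊆U (path≺star (m≤m+n m n) nᵢ eqᵢ (low a (n≤1+n 2)))
        , j⊆U′ (path≺star (m≤n+m n m) nⱼ eqⱼ (low b ≤-refl)))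
    where
    low : ∀ {a b c d} → a ⊴ b → b ≤ 3 → Attached a c d
    low (inj₁ refl)       b≤3 = inj₁ b≤3
    low (inj₂ (refl , _)) b≤3 = inj₁ z≤n

  not-regular : ∀ {f} → (∀ a → 4 ≤ a → Path a f) → ¬ Regular X
  not-regular {f} paths regular
    with W , open-W , x∈W , closure ←
           regular _ (basic-open _) (pathPoint (paths 4 ≤-refl)) (root∈ (paths 4 ≤-refl))
    with i , (nᵢ , inj₁ a≡4 , m , eqᵢ) , i⊆W ← open-W (pathPoint (paths 4 ≤-refl)) x∈W =
      -- The star label `initial f m`, the position of `i`, is the least one attached to `i`. Stars
      -- of this label far along `f` lie above `i` and above any given node of the path point for
      -- `5 + initial f m`. That point is thus adherent to `W`, but its label keeps it out of the
      -- neighbourhood given by the root of label 4.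
      let path₅ = paths (5 + initial f m) (m≤m+n 4 _) in
      case root∈⇒⊴ path₅ (closure (pathPoint path₅) λ where
        j (nⱼ , inj₁ b≡ , n , eqⱼ) → starPoint (star-element (initial f m) (initial f (m + n))) ,
          path≺star (m≤n+m n m) nⱼ eqⱼ (inj₂ (inj₂ b≡)) ,
          i⊆W (path≺star (m≤m+n m n) nᵢ eqᵢ (inj₂ (inj₁ (a≡4 , ≤-refl)))))
      of λ { (inj₁ ()) ; (inj₂ ()) }

-- The family of spaces belonging to three Π¹₁ sets

program : {P : Pred ℕ 0ℓ} → Π¹₁ P → Rec 2
program (_ , (c , _) , _) = c

∈⇒well-founded : {P : Pred ℕ 0ℓ} (π : Π¹₁ P) → ∀ {p} → p ∈ P →
                 ∀ f → ¬ (∀ n → Tree (program π) p (initial f n))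
∈⇒well-founded (R , ce , P⇔) {p} p∈ f path with n , r ← to (P⇔ p) p∈ f =
  Tree-initial⇒ ce p f path n r

∉⇒infinite-path : (∀ {ℓ} → ExcludedMiddle ℓ) → {P : Pred ℕ 0ℓ} (π : Π¹₁ P) → ∀ {p} → p ∉ P →
                  ∃[ f ] ∀ n → Tree (program π) p (initial f n)
∉⇒infinite-path em (R , ce , P⇔) {p} p∉ = decidable-stable em λ none →
  p∉ (from (P⇔ p) λ f → decidable-stable em λ never →
    none (f , Tree-initial⇐ ce p f λ n r → never (n , r)))

-- `Step` is already transitive, so passing to the closure leaves the relation given by the index
-- unchanged.
transitive-closure-⇔ : ∀ {R S : Rel ℕ 0ℓ} → (∀ i j → R i j ⇔ S i j) → Transitive S →
                       ∀ i j → TransClosure R i j ⇔ S i j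
transitive-closure-⇔ {R} {S} R⇔S S-trans i j = mk⇔ collapse ([_] ∘ from (R⇔S i j))
  where
  collapse : ∀ {i j} → TransClosure R i j → S i j
  collapse [ r ]    = to (R⇔S _ _) r
  collapse (r ∷ rs) = S-trans (to (R⇔S _ _) r) (collapse rs)

effectivelyHomeomorphic-refl : ∀ X → EffectivelyHomeomorphic X X
effectivelyHomeomorphic-refl X = inverse points , continuous , continuous
  where
  open NumberedSpace X
  continuous : EffectivelyContinuous X X id
  continuous = let c , c⇔ = semidecide (var {2} (# 0) ≡ʳ var (# 1)) in
    _≡_ , (c , λ m n → c⇔ (m ∷ n ∷ [])) ,
    λ n x → mk⇔ (λ x∈n → n , refl , x∈n) λ { (_ , refl , x∈n) → x∈n }

module Family (cᴹ cᴴ cᶠ : Rec 2) where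

  -- The label selects the tree: `cᶠ` for 0 and 1, `cᴴ` for 2 and 3, `cᴹ` for 4 and all `5 + b`.
  LabelledTree : ℕ → ℕ → ℕ → Set
  LabelledTree p a d =
    (a ≤ 1 → Tree cᶠ p d) × (2 ≤ a × a ≤ 3 → Tree cᴴ p d) × (4 ≤ a → Tree cᴹ p d)

  LabelledTree-closed : ∀ {p a c d} → c ⊑ d → LabelledTree p a d → LabelledTree p a c
  LabelledTree-closed c⊑d (t , t′ , t″) =
    Tree-closed c⊑d ∘ t , Tree-closed c⊑d ∘ t′ , Tree-closed c⊑d ∘ t″

  LabelledTree-⊴ : ∀ {p a b d} → a ⊴ b → LabelledTree p b d → LabelledTree p a d
  LabelledTree-⊴ (inj₁ refl) t = t
  LabelledTree-⊴ (inj₂ (refl , refl)) (t , _) = (λ _ → t ≤-refl) , (λ { (() , _) }) , λ ()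

  labelledᶠ : ∀ {p a d} → a ≤ 1 → Tree cᶠ p d → LabelledTree p a d
  labelledᶠ a≤1 t = (λ _ → t) ,
    (λ (2≤a , _) → contradiction (≤-trans 2≤a a≤1) (n≮n 1)) ,
    (λ 4≤a → contradiction (≤-trans 4≤a a≤1) (m+n≮n 2 1))

  labelledᴴ : ∀ {p a d} → 2 ≤ a → a ≤ 3 → Tree cᴴ p d → LabelledTree p a d
  labelledᴴ 2≤a a≤3 t = (λ a≤1 → contradiction (≤-trans 2≤a a≤1) (n≮n 1)) ,
    (λ _ → t) , (λ 4≤a → contradiction (≤-trans 4≤a a≤3) (n≮n 3))

  labelledᴹ : ∀ {p a d} → 4 ≤ a → Tree cᴹ p d → LabelledTree p a d
  labelledᴹ 4≤a t = (λ a≤1 → contradiction (≤-trans 4≤a a≤1) (m+n≮n 2 1)) ,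
    (λ (_ , a≤3) → contradiction (≤-trans 4≤a a≤3) (n≮n 3)) , (λ _ → t)

  Step-recursive : Recursive {3} λ xs →
    Step (LabelledTree (lookup xs (# 0))) (lookup xs (# 1)) (lookup xs (# 2))
  Step-recursive = Stepʳ {LabelledTree}
    ((a ≤ʳ constᵗ 1 →ʳ Treeʳ cᶠ p d)
      ×ʳ ((constᵗ 2 ≤ʳ a ×ʳ a ≤ʳ constᵗ 3) →ʳ Treeʳ cᴴ p d)
      ×ʳ (constᵗ 4 ≤ʳ a →ʳ Treeʳ cᴹ p d))
    where
    p : Total {3} (λ xs → lookup xs (# 0))
    p = var (# 0)
    a : Total {3} (λ xs → label (lookup xs (# 2)))
    a = lift₁ π₁-computable (lift₁ π₂-computable (var (# 2)))
    d : Total {3} (λ xs → pos (lookup xs (# 2)))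
    d = lift₁ π₂-computable (lift₁ π₂-computable (var (# 2)))

  effectiveQuasiPolish : ∀ {p} {_≺_ : Rel ℕ 0ℓ} → (∀ i j → i ≺ j ⇔ Step (LabelledTree p) i j) →
                         Transitive _≺_ → EffectiveQuasiPolish (𝓘 _≺_)
  effectiveQuasiPolish {p} {_≺_} ≺⇔ ≺-trans = _≺_ , ce , ≺-trans , effectivelyHomeomorphic-refl (𝓘 _≺_)
    where
    ce : CE₂ _≺_
    ce = let c , c⇔ = semidecide (composeʳ Step-recursive (constᵗ p ∷ᵗ idᵗ)) in
      c , λ m n → mk⇔ (to (c⇔ (m ∷ n ∷ [])) ∘ to (≺⇔ m n)) (from (≺⇔ m n) ∘ from (c⇔ (m ∷ n ∷ [])))

Properties : (M H F : Pred ℕ 0ℓ) → ℕ → NumberedSpace → Set₁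
Properties M H F p X =
  EffectiveQuasiPolish X × Overt X ×
  (p ∈ M → Metrizable X) ×
  (p ∈ H → p ∉ M → Hausdorff X × ¬ Metrizable X) ×
  (p ∈ F → p ∉ H → T₁ X × ¬ Hausdorff X) ×
  (p ∉ F → ¬ T₁ X)

module _ (em : ∀ {ℓ} → ExcludedMiddle ℓ) {M H F : Pred ℕ 0ℓ}
  (πᴹ : Π¹₁ M) (πᴴ : Π¹₁ H) (πᶠ : Π¹₁ F) (M⊆H : M ⊆ H) (H⊆F : H ⊆ F) where

  open Family (program πᴹ) (program πᴴ) (program πᶠ)

  properties : ∀ p {_≺_} → (∀ i j → i ≺ j ⇔ Step (LabelledTree p) i j) → Properties M H F p (𝓘 _≺_)
  properties p {_≺_} ≺⇔ =
    effectiveQuasiPolish {p} ≺⇔ S.≺-trans ,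
    S.overt ,
    (λ p∈M → Discrete.discrete⇒metrizable em (𝓘 _≺_) (S.isolated-points (no-path p∈M))) ,
    (λ p∈H p∉M → S.Hausdorff-space (λ a f → no-path-below-4 p∈H {a} {f}) ,
       let f , path = ∉⇒infinite-path em πᴹ p∉M in
       S.not-regular (λ a 4≤a n → labelledᴹ 4≤a (path n)) ∘ metrizable⇒regular (𝓘 _≺_)) ,
    (λ p∈F p∉H → S.T₁-space (λ a f → no-path-below-2 p∈F {a} {f}) ,
       let f , path = ∉⇒infinite-path em πᴴ p∉H in
       S.not-Hausdorff {f} (λ n → labelledᴴ ≤-refl (n≤1+n 2) (path n))
         (λ n → labelledᴴ (n≤1+n 2) ≤-refl (path n))) ,
    λ p∉F → let f , path = ∉⇒infinite-path em πᶠ p∉F in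
      S.not-T₁ {f} (λ n → labelledᶠ z≤n (path n)) (λ n → labelledᶠ ≤-refl (path n))
    where
    module S = Space em {LabelledTree p} LabelledTree-closed LabelledTree-⊴ ≺⇔
    no-path-below-2 : p ∈ F → ∀ {a f} → a < 2 → ¬ S.Path a f
    no-path-below-2 p∈F a<2 path = ∈⇒well-founded πᶠ p∈F _ λ n → proj₁ (path n) (s≤s⁻¹ a<2)
    no-path-below-4 : p ∈ H → ∀ {a f} → a < 4 → ¬ S.Path a f
    no-path-below-4 p∈H {a} a<4 path with a <? 2
    ... | yes a<2 = no-path-below-2 (H⊆F p∈H) a<2 path
    ... | no a≮2  = ∈⇒well-founded πᴴ p∈H _ λ n → proj₁ (proj₂ (path n)) (≮⇒≥ a≮2 , s≤s⁻¹ a<4)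
    no-path : p ∈ M → ∀ a f → ¬ S.Path a f
    no-path p∈M a f path with a <? 4
    ... | yes a<4 = no-path-below-4 (M⊆H p∈M) a<4 path
    ... | no a≮4  = ∈⇒well-founded πᴹ p∈M _ λ n → proj₂ (proj₂ (path n)) (≮⇒≥ a≮4)

theorem26 :
    (∀ {ℓ} → ExcludedMiddle ℓ) →
    (t : ℕ → ℕ) → ComputesTransClosure t →
    (M H F : Pred ℕ 0ℓ) → Π¹₁ M → Π¹₁ H → Π¹₁ F → M ⊆ H → H ⊆ F →
    Σ (ℕ → ℕ) λ g → Computable g ×
      (∀ p → let X = ι t (g p) in
        EffectiveQuasiPolish X × Overt X ×
        (p ∈ M → Metrizable X) ×
        (p ∈ H → p ∉ M → Hausdorff X × ¬ Metrizable X) ×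
        (p ∈ F → p ∉ H → T₁ X × ¬ Hausdorff X) ×
        (p ∉ F → ¬ T₁ X))
theorem26 em t (_ , closure) M H F πᴹ πᴴ πᶠ M⊆H H⊆F =
  let open Family (program πᴹ) (program πᴴ) (program πᶠ)
      g , g-computable , V⇔ = index Step-recursive
  in g , g-computable , λ p → properties em πᴹ πᴴ πᶠ M⊆H H⊆F p λ i j →
    let V⇔Step = transitive-closure-⇔ (V⇔ p) Step-trans i j
        closed = closure (g p) i j
    in mk⇔ (to V⇔Step ∘ to closed) (from closed ∘ from V⇔Step)
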